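{- Let $\mathcal{M} \models \mathsf{PA}$ and $I \subseteq_e M$. The following are equivalent: (1) $I$ is $\omega$-coded and separable; (2) $I$ is $0$-superrational.
   Context: $I\subseteq_e M$ is a cut of $M$; $(a)_i$ denotes the $i$-th element of the sequence coded by $a$. $I$ is separable if for each $a\in M$ there is $c\in M$ such that for each $n\in\omega$, $(a)_n\in I$ iff $\mathcal{M}\models n\in c$. $I$ is coded by $\omega$ from below if there is $a\in M$ with $I = \sup(\{(a)_i : i\in\omega\})$, and coded by $\omega$ from above if there is $a\in M$ with $I=\inf(\{(a)_i: i\in\omega\})$; $I$ is $\omega$-coded if it is coded by $\omega$ from below or from above. $\mathrm{Def}_0(a)$ is the set of elements of $\mathcal{M}$ that are $\Delta_0$-definable from $a$ in $\mathcal{M}$. $I$ is $0$-superrational if there is $a \in M$ such that either $\mathrm{Def}_0(a)\cap I$ is cofinal in $I$ and for all $b\in M$, $\mathrm{Def}_0(b)\setminus I$ is not coinitial in $M\setminus I$; or $\mathrm{Def}_0(a)\setminus I$ is coinitial in $M\setminus I$ and for all $b\in M$, $\mathrm{Def}_0(b)\cap I$ is not cofinal in $I$. -}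

module Defs where

open import Level using (0ℓ)
open import Data.Nat using (ℕ; zero; suc; _^_)
open import Data.Fin using (Fin)
open import Data.Vec.Functional using (_∷_)
open import Data.Product using (Σ; _×_; _,_; ∃)
open import Data.Sum using (_⊎_)
open import Data.Empty using (⊥)
open import Relation.Nullary using (¬_)
open import Relation.Binary.PropositionalEquality using (_≡_)
open import Function.Bundles using (_⇔_)

-- The first-order language L_A = {0, 1, +, ·, <} (Kaye's convention),
-- with de Bruijn variables.  Bounded quantifiers are primitive
-- constructors; (∀< t φ) means ∀x (x < t → φ) where x is not free in t.

data Term (n : ℕ) : Set where
  var  : Fin n → Term n
  `0   : Term n
  `1   : Term n
  _`+_ : Term n → Term n → Term n
  _`*_ : Term n → Term n → Term n

data Formula : ℕ → Set where
  _`≡_ : ∀ {n} → Term n → Term n → Formula n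
  _`<_ : ∀ {n} → Term n → Term n → Formula n
  `⊥   : ∀ {n} → Formula n
  _`∧_ : ∀ {n} → Formula n → Formula n → Formula n
  _`∨_ : ∀ {n} → Formula n → Formula n → Formula n
  _`⇒_ : ∀ {n} → Formula n → Formula n → Formula n
  `∀   : ∀ {n} → Formula (suc n) → Formula n
  `∃   : ∀ {n} → Formula (suc n) → Formula n
  `∀<  : ∀ {n} → Term n → Formula (suc n) → Formula n
  `∃<  : ∀ {n} → Term n → Formula (suc n) → Formula n

data Δ₀ : ∀ {n} → Formula n → Set where
  eq  : ∀ {n} (s t : Term n) → Δ₀ (s `≡ t)
  lt  : ∀ {n} (s t : Term n) → Δ₀ (s `< t)
  bot : ∀ {n} → Δ₀ {n} `⊥
  and : ∀ {n} {φ ψ : Formula n} → Δ₀ φ → Δ₀ ψ → Δ₀ (φ `∧ ψ)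
  or  : ∀ {n} {φ ψ : Formula n} → Δ₀ φ → Δ₀ ψ → Δ₀ (φ `∨ ψ)
  imp : ∀ {n} {φ ψ : Formula n} → Δ₀ φ → Δ₀ ψ → Δ₀ (φ `⇒ ψ)
  ball : ∀ {n} (t : Term n) {φ : Formula (suc n)} → Δ₀ φ → Δ₀ (`∀< t φ)
  bex  : ∀ {n} (t : Term n) {φ : Formula (suc n)} → Δ₀ φ → Δ₀ (`∃< t φ)

record Structure : Set₁ where
  field
    Carrier : Set
    O I     : Carrier
    _⊕_ _⊗_ : Carrier → Carrier → Carrier
    _≺_     : Carrier → Carrier → Set

module Sem (M : Structure) where
  open Structure M

  Env : ℕ → Set
  Env n = Fin n → Carrier

  ⟦_⟧ : ∀ {n} → Term n → Env n → Carrier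
  ⟦ var i ⟧ ρ = ρ i
  ⟦ `0 ⟧ ρ = O
  ⟦ `1 ⟧ ρ = I
  ⟦ s `+ t ⟧ ρ = ⟦ s ⟧ ρ ⊕ ⟦ t ⟧ ρ
  ⟦ s `* t ⟧ ρ = ⟦ s ⟧ ρ ⊗ ⟦ t ⟧ ρ

  Sat : ∀ {n} → Formula n → Env n → Set
  Sat (s `≡ t) ρ = ⟦ s ⟧ ρ ≡ ⟦ t ⟧ ρ
  Sat (s `< t) ρ = ⟦ s ⟧ ρ ≺ ⟦ t ⟧ ρ
  Sat `⊥ ρ = ⊥
  Sat (φ `∧ ψ) ρ = Sat φ ρ × Sat ψ ρ
  Sat (φ `∨ ψ) ρ = Sat φ ρ ⊎ Sat ψ ρ
  Sat (φ `⇒ ψ) ρ = Sat φ ρ → Sat ψ ρ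
  Sat (`∀ φ) ρ = (x : Carrier) → Sat φ (x ∷ ρ)
  Sat (`∃ φ) ρ = Σ Carrier λ x → Sat φ (x ∷ ρ)
  Sat (`∀< t φ) ρ = (x : Carrier) → x ≺ ⟦ t ⟧ ρ → Sat φ (x ∷ ρ)
  Sat (`∃< t φ) ρ = Σ Carrier λ x → x ≺ ⟦ t ⟧ ρ × Sat φ (x ∷ ρ)

-- M ⊨ PA: the axioms of PA⁻ (Kaye, Models of Peano Arithmetic, §2.1)
-- together with the induction schema for all L_A-formulas with parameters.
record IsPA (M : Structure) : Set₁ where
  open Structure M
  open Sem M
  field
    +-assoc  : ∀ x y z → (x ⊕ y) ⊕ z ≡ x ⊕ (y ⊕ z)
    +-comm   : ∀ x y → x ⊕ y ≡ y ⊕ x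
    *-assoc  : ∀ x y z → (x ⊗ y) ⊗ z ≡ x ⊗ (y ⊗ z)
    *-comm   : ∀ x y → x ⊗ y ≡ y ⊗ x
    distrib  : ∀ x y z → x ⊗ (y ⊕ z) ≡ (x ⊗ y) ⊕ (x ⊗ z)
    +-identity : ∀ x → x ⊕ O ≡ x
    *-zero   : ∀ x → x ⊗ O ≡ O
    *-identity : ∀ x → x ⊗ I ≡ x
    <-trans  : ∀ x y z → x ≺ y → y ≺ z → x ≺ z
    <-irrefl : ∀ x → ¬ (x ≺ x)
    <-trichotomy : ∀ x y → (x ≺ y) ⊎ (x ≡ y) ⊎ (y ≺ x)
    +-mono-< : ∀ x y z → x ≺ y → (x ⊕ z) ≺ (y ⊕ z)
    *-mono-< : ∀ x y z → O ≺ z → x ≺ y → (x ⊗ z) ≺ (y ⊗ z)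
    <-diff   : ∀ x y → x ≺ y → Σ Carrier λ z → x ⊕ z ≡ y
    0<1      : O ≺ I
    discrete : ∀ x → O ≺ x → (I ≺ x) ⊎ (I ≡ x)
    0-least  : ∀ x → (O ≺ x) ⊎ (O ≡ x)
    induction : ∀ {n} (φ : Formula (suc n)) (ρ : Env n) →
                Sat φ (O ∷ ρ) →
                (∀ x → Sat φ (x ∷ ρ) → Sat φ ((x ⊕ I) ∷ ρ)) →
                ∀ x → Sat φ (x ∷ ρ)

record ModelPA : Set₁ where
  field
    structure : Structure
    isPA      : IsPA structure
  open Structure structure public

module Notions (M : ModelPA) where
  open ModelPA M
  open Sem structure

  _≼_ : Carrier → Carrier → Set
  x ≼ y = (x ≺ y) ⊎ (x ≡ y)

  num : ℕ → Carrier
  num zero = O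
  num (suc n) = num n ⊕ I

  record IsCut (C : Carrier → Set) : Set where
    field
      nonempty   : C O
      initial    : ∀ x y → x ≺ y → C y → C x
      succClosed : ∀ x → C x → C (x ⊕ I)
      proper     : Σ Carrier λ x → ¬ C x

  -- Sequence coding: (a)_i = x, for standard i, via Gödel's β-function,
  -- a = ⟨u , v⟩ (Cantor pairing: 2a = (u+v)(u+v+1) + 2u) and
  -- (a)_i = u mod (1 + (i+1)·v).
  Elem : Carrier → ℕ → Carrier → Set
  Elem a i x = Σ Carrier λ u → Σ Carrier λ v →
    ((((u ⊕ v) ⊗ ((u ⊕ v) ⊕ I)) ⊕ (u ⊕ u)) ≡ (a ⊕ a)) ×
    (Σ Carrier λ q → (u ≡ (q ⊗ (I ⊕ (num (suc i) ⊗ v))) ⊕ x)) ×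
    (x ≺ (I ⊕ (num (suc i) ⊗ v)))

  -- Ackermann membership "M ⊨ n ∈ c" for standard n:
  -- the n-th binary digit of c is 1.
  _∈ₐ_ : ℕ → Carrier → Set
  n ∈ₐ c = Σ Carrier λ q → Σ Carrier λ r →
    (c ≡ ((q ⊗ num (2 ^ suc n)) ⊕ num (2 ^ n)) ⊕ r) × (r ≺ num (2 ^ n))

  Separable : (Carrier → Set) → Set
  Separable C = ∀ a → Σ Carrier λ c → ∀ (n : ℕ) →
    (Σ Carrier λ x → Elem a n x × C x) ⇔ (n ∈ₐ c)

  CodedFromBelow : (Carrier → Set) → Set
  CodedFromBelow C = Σ Carrier λ a → ∀ x →
    C x ⇔ (Σ ℕ λ i → Σ Carrier λ y → Elem a i y × x ≼ y)

  CodedFromAbove : (Carrier → Set) → Set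
  CodedFromAbove C = Σ Carrier λ a → ∀ x →
    C x ⇔ (∀ (i : ℕ) (y : Carrier) → Elem a i y → x ≺ y)

  ωCoded : (Carrier → Set) → Set
  ωCoded C = CodedFromBelow C ⊎ CodedFromAbove C

  Def₀ : Carrier → Carrier → Set
  Def₀ a b = Σ (Formula 2) λ φ → Δ₀ φ ×
    (∀ y → Sat φ (y ∷ (a ∷ λ ())) ⇔ (y ≡ b))

  CofinalIn : (Carrier → Set) → (Carrier → Set) → Set
  CofinalIn S C = ∀ x → C x → Σ Carrier λ y → S y × C y × x ≼ y

  CoinitialAbove : (Carrier → Set) → (Carrier → Set) → Set
  CoinitialAbove S C = ∀ x → ¬ C x → Σ Carrier λ y → S y × ¬ C y × y ≼ x

  ZeroSuperrational : (Carrier → Set) → Set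
  ZeroSuperrational C = Σ Carrier λ a →
      (CofinalIn (Def₀ a) C × (∀ b → ¬ CoinitialAbove (Def₀ b) C))
    ⊎ (CoinitialAbove (Def₀ a) C × (∀ b → ¬ CofinalIn (Def₀ b) C))

{-# OPTIONS --safe #-}
-- Let (a)ᵢ also denote the β-function at nonstandard i.  The key fact is that for all a and e some
-- sequence d has every Δ₀-definable-from-a element below e among its entries (d)ₖ, k ∈ ω: a coded
-- table holds, for nonstandardly many indices, functions of environments r, where environments are
-- numbers written in a base B exceeding all polynomials in a and e, and each function is obtained
-- from earlier ones by a projection, +, ·, equality or bounded minimisation; Δ₀-formulas occur at
-- standard indices.  As (a)ᵢ is Δ₀-definable from a for i ∈ ω, "some Def₀(a) ∩ I is cofinal in I"
-- thus means that some sequence (a)ᵢ, i ∈ ω, has its terms in I cofinal in I, and dually.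
--
-- If I is separable, then no sequence can approach I cofinally from below while another one
-- approaches it coinitially from above: overspill on "some z separates the terms of index < n
-- inside I from those outside I" gives a z that is neither in I nor outside I.  Conversely, if Def₀(a)
-- is not coinitial above I, some z ∉ I is below all (a)ₙ ∉ I, and {n : (a)ₙ ≤ z} is coded; dually
-- from below.  Separability also lets one replace the terms of a sequence that lie on the wrong
-- side of I, so cofinal and coinitial sequences become codes of I.
module Submission where

open import Defs
open import Level using (0ℓ)
open import Data.Product using (_×_)
open import Function.Bundles using (_⇔_)
open import Axiom.ExcludedMiddle using (ExcludedMiddle)
open import Algebra.Bundles using (CommutativeSemiring)
open import Algebra.Structures.Biased using (isCommutativeSemiringˡ)
import Algebra.Solver.Ring.NaturalCoefficients.Default as NaturalSolver
open import Data.Empty using (⊥; ⊥-elim)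
open import Data.Fin using (Fin; zero; suc; #_)
open import Data.Nat.Base as ℕ using (ℕ; zero; suc)
open import Data.Nat.Properties as ℕₚ using ()
open import Data.Product using (Σ; _,_; proj₁; proj₂)
open import Data.Sum as Sum using (_⊎_; inj₁; inj₂; [_,_]′)
open import Data.Unit using (⊤; tt)
open import Data.Vec.Functional using (_∷_)
open import Function.Bundles using (mk⇔; Equivalence)
open import Relation.Binary.PropositionalEquality using (_≡_; _≢_; refl; sym; trans; cong; cong₂; subst; subst₂; isEquivalence)
open import Relation.Nullary using (¬_; yes; no)

module _ (em : ExcludedMiddle 0ℓ) (M : ModelPA) where

  -- Arithmetic in M

  open ModelPA M
  open IsPA isPA
  open Sem structure
  open Notions M

  ⊕-identityˡ : ∀ x → O ⊕ x ≡ x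
  ⊕-identityˡ x = trans (+-comm O x) (+-identity x)

  ⊗-identityˡ : ∀ x → I ⊗ x ≡ x
  ⊗-identityˡ x = trans (*-comm I x) (*-identity x)

  ⊗-zeroˡ : ∀ x → O ⊗ x ≡ O
  ⊗-zeroˡ x = trans (*-comm O x) (*-zero x)

  ⊗-distribʳ : ∀ x y z → (y ⊕ z) ⊗ x ≡ (y ⊗ x) ⊕ (z ⊗ x)
  ⊗-distribʳ x y z =
    trans (*-comm (y ⊕ z) x) (trans (distrib x y z) (cong₂ _⊕_ (*-comm x y) (*-comm x z)))

  commutativeSemiring : CommutativeSemiring 0ℓ 0ℓ
  commutativeSemiring = record
    { Carrier = Carrier ; _≈_ = _≡_ ; _+_ = _⊕_ ; _*_ = _⊗_ ; 0# = O ; 1# = I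
    ; isCommutativeSemiring = isCommutativeSemiringˡ (record
        { +-isCommutativeMonoid = record
            { isMonoid = record
                { isSemigroup = record
                    { isMagma = record { isEquivalence = isEquivalence ; ∙-cong = cong₂ _⊕_ }
                    ; assoc = +-assoc }
                ; identity = ⊕-identityˡ , +-identity }
            ; comm = +-comm }
        ; *-isCommutativeMonoid = record
            { isMonoid = record
                { isSemigroup = record
                    { isMagma = record { isEquivalence = isEquivalence ; ∙-cong = cong₂ _⊗_ }
                    ; assoc = *-assoc }
                ; identity = ⊗-identityˡ , *-identity }
            ; comm = *-comm }
        ; distribʳ = ⊗-distribʳ
        ; zeroˡ = ⊗-zeroˡ }) }

  open NaturalSolver commutativeSemiring using (solve; con; _:+_; _:*_; _:=_)

  opaque
    ≼-refl : ∀ {x} → x ≼ x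
    ≼-refl = inj₂ refl

    ≺-≼-trans : ∀ {x y z} → x ≺ y → y ≼ z → x ≺ z
    ≺-≼-trans p (inj₁ q) = <-trans _ _ _ p q
    ≺-≼-trans p (inj₂ refl) = p

    ≼-≺-trans : ∀ {x y z} → x ≼ y → y ≺ z → x ≺ z
    ≼-≺-trans (inj₁ p) q = <-trans _ _ _ p q
    ≼-≺-trans (inj₂ refl) q = q

    ≼-trans : ∀ {x y z} → x ≼ y → y ≼ z → x ≼ z
    ≼-trans (inj₁ p) q = inj₁ (≺-≼-trans p q)
    ≼-trans (inj₂ refl) q = q

    ≼⇒⊁ : ∀ {x y} → x ≼ y → ¬ (y ≺ x)
    ≼⇒⊁ p q = <-irrefl _ (≼-≺-trans p q)

    ≼-antisym : ∀ {x y} → x ≼ y → y ≼ x → x ≡ y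
    ≼-antisym (inj₂ p) _ = p
    ≼-antisym (inj₁ p) q = ⊥-elim (≼⇒⊁ q p)

    ≼-or-≻ : ∀ x y → (x ≼ y) ⊎ (y ≺ x)
    ≼-or-≻ x y with <-trichotomy x y
    ... | inj₁ p = inj₁ (inj₁ p)
    ... | inj₂ (inj₁ p) = inj₁ (inj₂ p)
    ... | inj₂ (inj₂ p) = inj₂ p

    ⊀⇒≽ : ∀ {x y} → ¬ (x ≺ y) → y ≼ x
    ⊀⇒≽ {x} {y} p with ≼-or-≻ y x
    ... | inj₁ q = q
    ... | inj₂ q = ⊥-elim (p q)

    O≼ : ∀ x → O ≼ x
    O≼ = 0-least

    ⊀O : ∀ {x} → ¬ (x ≺ O)
    ⊀O p = ≼⇒⊁ (O≼ _) p

    x≼x⊕y : ∀ x y → x ≼ (x ⊕ y)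
    x≼x⊕y x y with 0-least y
    ... | inj₁ p = inj₁ (subst₂ _≺_ (⊕-identityˡ x) (+-comm y x) (+-mono-< O y x p))
    ... | inj₂ refl = inj₂ (sym (+-identity x))

    x≼y⊕x : ∀ x y → x ≼ (y ⊕ x)
    x≼y⊕x x y = subst (x ≼_) (+-comm x y) (x≼x⊕y x y)

    x≺x⊕I : ∀ x → x ≺ (x ⊕ I)
    x≺x⊕I x = subst₂ _≺_ (⊕-identityˡ x) (+-comm I x) (+-mono-< O I x 0<1)

    ≼⇒∃ : ∀ {x y} → x ≼ y → Σ Carrier λ z → x ⊕ z ≡ y
    ≼⇒∃ (inj₁ p) = <-diff _ _ p
    ≼⇒∃ {x} (inj₂ refl) = O , +-identity x

    ≼-by : ∀ {x y} z → x ⊕ z ≡ y → x ≼ y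
    ≼-by {x} z refl = x≼x⊕y x z

    ≺⇒sucˡ≼ : ∀ {x y} → x ≺ y → (x ⊕ I) ≼ y
    ≺⇒sucˡ≼ {x} {y} p with <-diff x y p
    ... | z , refl with 0-least z
    ...   | inj₂ refl = ⊥-elim (<-irrefl x (subst (x ≺_) (+-identity x) p))
    ...   | inj₁ q with discrete z q
    ...     | inj₂ refl = ≼-refl
    ...     | inj₁ r = inj₁ (subst₂ _≺_ (+-comm I x) (+-comm z x) (+-mono-< I z x r))

    sucˡ≼⇒≺ : ∀ {x y} → (x ⊕ I) ≼ y → x ≺ y
    sucˡ≼⇒≺ p = ≺-≼-trans (x≺x⊕I _) p

    ≼⇒≺suc : ∀ {x y} → x ≼ y → x ≺ (y ⊕ I)
    ≼⇒≺suc p = ≼-≺-trans p (x≺x⊕I _)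

    ≺suc⇒≼ : ∀ {x y} → x ≺ (y ⊕ I) → x ≼ y
    ≺suc⇒≼ {x} {y} p with ≼-or-≻ x y
    ... | inj₁ q = q
    ... | inj₂ q = ⊥-elim (≼⇒⊁ (≺⇒sucˡ≼ q) p)

    ≺⇒∃ : ∀ {x y} → x ≺ y → Σ Carrier λ z → (x ⊕ I) ⊕ z ≡ y
    ≺⇒∃ p = ≼⇒∃ (≺⇒sucˡ≼ p)

    ≺-by : ∀ {x y} z → (x ⊕ I) ⊕ z ≡ y → x ≺ y
    ≺-by z e = sucˡ≼⇒≺ (≼-by z e)

    zero-or-suc : ∀ x → (x ≡ O) ⊎ (Σ Carrier λ y → x ≡ y ⊕ I)
    zero-or-suc x with 0-least x
    ... | inj₂ refl = inj₁ refl
    ... | inj₁ p with ≺⇒∃ p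
    ...   | z , refl = inj₂ (z , solve 1 (λ z → con 0 :+ con 1 :+ z := z :+ con 1) refl z)

    ≢O⇒O≺ : ∀ {x} → x ≢ O → O ≺ x
    ≢O⇒O≺ {x} p with 0-least x
    ... | inj₁ q = q
    ... | inj₂ q = ⊥-elim (p (sym q))

    O≺⇒≢O : ∀ {x} → O ≺ x → x ≢ O
    O≺⇒≢O p refl = <-irrefl _ p

    O≺suc : ∀ x → O ≺ (x ⊕ I)
    O≺suc x = ≼⇒≺suc (O≼ x)

    suc≢O : ∀ {x} → x ⊕ I ≢ O
    suc≢O {x} = O≺⇒≢O (O≺suc x)

    I≢O : I ≢ O
    I≢O = O≺⇒≢O 0<1

    ⊕-cancelʳ : ∀ z {x y} → x ⊕ z ≡ y ⊕ z → x ≡ y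
    ⊕-cancelʳ z {x} {y} e with <-trichotomy x y
    ... | inj₁ p = ⊥-elim (<-irrefl _ (subst (_≺ (y ⊕ z)) e (+-mono-< x y z p)))
    ... | inj₂ (inj₁ p) = p
    ... | inj₂ (inj₂ p) = ⊥-elim (<-irrefl _ (subst ((y ⊕ z) ≺_) e (+-mono-< y x z p)))

    ⊕-cancelˡ : ∀ z {x y} → z ⊕ x ≡ z ⊕ y → x ≡ y
    ⊕-cancelˡ z {x} {y} e = ⊕-cancelʳ z (trans (+-comm x z) (trans e (+-comm z y)))

    suc-≺ : ∀ {x y} → x ≺ y → (x ⊕ I) ≺ (y ⊕ I)
    suc-≺ = +-mono-< _ _ I

    ⊕-mono-≼ : ∀ {x y z w} → x ≼ y → z ≼ w → (x ⊕ z) ≼ (y ⊕ w)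
    ⊕-mono-≼ {x} {z = z} p q with ≼⇒∃ p | ≼⇒∃ q
    ... | a , refl | b , refl =
      ≼-by (a ⊕ b) (solve 4 (λ x z a b → x :+ z :+ (a :+ b) := x :+ a :+ (z :+ b)) refl x z a b)

    ⊗-mono-≼ : ∀ {x y z w} → x ≼ y → z ≼ w → (x ⊗ z) ≼ (y ⊗ w)
    ⊗-mono-≼ {x} {z = z} p q with ≼⇒∃ p | ≼⇒∃ q
    ... | a , refl | b , refl = ≼-by (((x ⊗ b) ⊕ (a ⊗ z)) ⊕ (a ⊗ b))
      (solve 4 (λ x z a b → x :* z :+ (x :* b :+ a :* z :+ a :* b) := (x :+ a) :* (z :+ b)) refl x z a b)

    ⊗-nonzero : ∀ {x y} → x ≢ O → y ≢ O → x ⊗ y ≢ O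
    ⊗-nonzero {x} {y} p q e = O≺⇒≢O
      (subst (_≺ (x ⊗ y)) (⊗-zeroˡ y) (*-mono-< O x y (≢O⇒O≺ q) (≢O⇒O≺ p))) e

    ⊕-zeroˡ⁻ : ∀ {x y} → x ⊕ y ≡ O → x ≡ O
    ⊕-zeroˡ⁻ {x} {y} e = ≼-antisym (subst (x ≼_) e (x≼x⊕y x y)) (O≼ x)

    ⊕-zeroʳ⁻ : ∀ {x y} → x ⊕ y ≡ O → y ≡ O
    ⊕-zeroʳ⁻ {x} {y} e = ⊕-zeroˡ⁻ (trans (+-comm y x) e)

    double-injective : ∀ {x y} → x ⊕ x ≡ y ⊕ y → x ≡ y
    double-injective {x} {y} e with <-trichotomy x y
    ... | inj₁ p = ⊥-elim (<-irrefl _ (subst (_≺ (y ⊕ y)) e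
          (≺-≼-trans (+-mono-< x y x p) (⊕-mono-≼ ≼-refl (inj₁ p)))))
    ... | inj₂ (inj₁ p) = p
    ... | inj₂ (inj₂ p) = ⊥-elim (<-irrefl _ (subst ((y ⊕ y) ≺_) e
          (≺-≼-trans (+-mono-< y x y p) (⊕-mono-≼ ≼-refl (inj₁ p)))))

    x≼x⊗sucy : ∀ x y → x ≼ (x ⊗ (y ⊕ I))
    x≼x⊗sucy x y = ≼-by (x ⊗ y) (solve 2 (λ x y → x :+ x :* y := x :* (y :+ con 1)) refl x y)

    quotient-≮ : ∀ {m q q′ x x′} → x ≺ m →
      (q ⊗ m) ⊕ x ≡ (q′ ⊗ m) ⊕ x′ → ¬ (q ≺ q′)
    quotient-≮ {m} {q} {q′} {x} {x′} p e r with ≺⇒∃ r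
    ... | z , refl = <-irrefl _ (subst (_≺ (((q′) ⊗ m) ⊕ x′)) e
      (≺-≼-trans (subst₂ _≺_ (+-comm x (q ⊗ m)) (+-comm m (q ⊗ m)) (+-mono-< x m (q ⊗ m) p))
        (≼-by ((z ⊗ m) ⊕ x′) (solve 4
          (λ q m z x → q :* m :+ m :+ (z :* m :+ x) := (q :+ con 1 :+ z) :* m :+ x) refl q m z x′))))

    division-unique : ∀ {m q q′ x x′} → x ≺ m → x′ ≺ m →
      (q ⊗ m) ⊕ x ≡ (q′ ⊗ m) ⊕ x′ → q ≡ q′ × x ≡ x′
    division-unique {m} {q} {q′} {x} {x′} p p′ e with <-trichotomy q q′
    ... | inj₁ r = ⊥-elim (quotient-≮ p e r)
    ... | inj₂ (inj₂ r) = ⊥-elim (quotient-≮ p′ (sym e) r)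
    ... | inj₂ (inj₁ refl) = refl , ⊕-cancelˡ (q ⊗ m) e

    num-+ : ∀ m n → num (m ℕ.+ n) ≡ num m ⊕ num n
    num-+ zero n = sym (⊕-identityˡ (num n))
    num-+ (suc m) n rewrite num-+ m n =
      solve 2 (λ x y → x :+ y :+ con 1 := x :+ con 1 :+ y) refl (num m) (num n)

    ≺num⇒standard : ∀ {x} n → x ≺ num n → Σ ℕ λ k → k ℕ.< n × x ≡ num k
    ≺num⇒standard zero p = ⊥-elim (⊀O p)
    ≺num⇒standard (suc n) p with ≺suc⇒≼ p
    ... | inj₂ e = n , ℕₚ.n<1+n n , e
    ... | inj₁ q with ≺num⇒standard n q
    ...   | k , k<n , e = k , ℕₚ.m<n⇒m<1+n k<n , e

  -- Renaming of variables, the least number principle and overspill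

  liftᵣ : ∀ {m n} → (Fin m → Fin n) → Fin (suc m) → Fin (suc n)
  liftᵣ f zero = zero
  liftᵣ f (suc i) = suc (f i)

  renᵗ : ∀ {m n} → (Fin m → Fin n) → Term m → Term n
  renᵗ f (var i) = var (f i)
  renᵗ f `0 = `0
  renᵗ f `1 = `1
  renᵗ f (s `+ t) = renᵗ f s `+ renᵗ f t
  renᵗ f (s `* t) = renᵗ f s `* renᵗ f t

  ren : ∀ {m n} → (Fin m → Fin n) → Formula m → Formula n
  ren f (s `≡ t) = renᵗ f s `≡ renᵗ f t
  ren f (s `< t) = renᵗ f s `< renᵗ f t
  ren f `⊥ = `⊥
  ren f (φ `∧ ψ) = ren f φ `∧ ren f ψ
  ren f (φ `∨ ψ) = ren f φ `∨ ren f ψ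
  ren f (φ `⇒ ψ) = ren f φ `⇒ ren f ψ
  ren f (`∀ φ) = `∀ (ren (liftᵣ f) φ)
  ren f (`∃ φ) = `∃ (ren (liftᵣ f) φ)
  ren f (`∀< t φ) = `∀< (renᵗ f t) (ren (liftᵣ f) φ)
  ren f (`∃< t φ) = `∃< (renᵗ f t) (ren (liftᵣ f) φ)

  infix 4 _≗[_]_
  _≗[_]_ : ∀ {m n} → Env m → (Fin m → Fin n) → Env n → Set
  ρ ≗[ f ] σ = ∀ i → ρ i ≡ σ (f i)

  ≗-lift : ∀ {m n} {f : Fin m → Fin n} {ρ σ} x → ρ ≗[ f ] σ → (x ∷ ρ) ≗[ liftᵣ f ] (x ∷ σ)
  ≗-lift x e zero = refl
  ≗-lift x e (suc i) = e i

  ⟦renᵗ⟧ : ∀ {m n} {f : Fin m → Fin n} {ρ σ} → ρ ≗[ f ] σ → ∀ t → ⟦ renᵗ f t ⟧ σ ≡ ⟦ t ⟧ ρ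
  ⟦renᵗ⟧ e (var i) = sym (e i)
  ⟦renᵗ⟧ e `0 = refl
  ⟦renᵗ⟧ e `1 = refl
  ⟦renᵗ⟧ e (s `+ t) = cong₂ _⊕_ (⟦renᵗ⟧ e s) (⟦renᵗ⟧ e t)
  ⟦renᵗ⟧ e (s `* t) = cong₂ _⊗_ (⟦renᵗ⟧ e s) (⟦renᵗ⟧ e t)

  Sat-ren⁻ : ∀ {m n} {f : Fin m → Fin n} {ρ σ} → ρ ≗[ f ] σ → ∀ φ → Sat (ren f φ) σ → Sat φ ρ
  Sat-ren⁺ : ∀ {m n} {f : Fin m → Fin n} {ρ σ} → ρ ≗[ f ] σ → ∀ φ → Sat φ ρ → Sat (ren f φ) σ

  Sat-ren⁻ e (s `≡ t) p = trans (sym (⟦renᵗ⟧ e s)) (trans p (⟦renᵗ⟧ e t))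
  Sat-ren⁻ e (s `< t) p = subst₂ _≺_ (⟦renᵗ⟧ e s) (⟦renᵗ⟧ e t) p
  Sat-ren⁻ e (φ `∧ ψ) (p , q) = Sat-ren⁻ e φ p , Sat-ren⁻ e ψ q
  Sat-ren⁻ e (φ `∨ ψ) (inj₁ p) = inj₁ (Sat-ren⁻ e φ p)
  Sat-ren⁻ e (φ `∨ ψ) (inj₂ p) = inj₂ (Sat-ren⁻ e ψ p)
  Sat-ren⁻ e (φ `⇒ ψ) p q = Sat-ren⁻ e ψ (p (Sat-ren⁺ e φ q))
  Sat-ren⁻ e (`∀ φ) p x = Sat-ren⁻ (≗-lift x e) φ (p x)
  Sat-ren⁻ e (`∃ φ) (x , p) = x , Sat-ren⁻ (≗-lift x e) φ p
  Sat-ren⁻ e (`∀< t φ) p x q =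
    Sat-ren⁻ (≗-lift x e) φ (p x (subst (x ≺_) (sym (⟦renᵗ⟧ e t)) q))
  Sat-ren⁻ e (`∃< t φ) (x , q , p) =
    x , subst (x ≺_) (⟦renᵗ⟧ e t) q , Sat-ren⁻ (≗-lift x e) φ p

  Sat-ren⁺ e (s `≡ t) p = trans (⟦renᵗ⟧ e s) (trans p (sym (⟦renᵗ⟧ e t)))
  Sat-ren⁺ e (s `< t) p = subst₂ _≺_ (sym (⟦renᵗ⟧ e s)) (sym (⟦renᵗ⟧ e t)) p
  Sat-ren⁺ e (φ `∧ ψ) (p , q) = Sat-ren⁺ e φ p , Sat-ren⁺ e ψ q
  Sat-ren⁺ e (φ `∨ ψ) (inj₁ p) = inj₁ (Sat-ren⁺ e φ p)
  Sat-ren⁺ e (φ `∨ ψ) (inj₂ p) = inj₂ (Sat-ren⁺ e ψ p)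
  Sat-ren⁺ e (φ `⇒ ψ) p q = Sat-ren⁺ e ψ (p (Sat-ren⁻ e φ q))
  Sat-ren⁺ e (`∀ φ) p x = Sat-ren⁺ (≗-lift x e) φ (p x)
  Sat-ren⁺ e (`∃ φ) (x , p) = x , Sat-ren⁺ (≗-lift x e) φ p
  Sat-ren⁺ e (`∀< t φ) p x q =
    Sat-ren⁺ (≗-lift x e) φ (p x (subst (x ≺_) (⟦renᵗ⟧ e t) q))
  Sat-ren⁺ e (`∃< t φ) (x , q , p) =
    x , subst (x ≺_) (sym (⟦renᵗ⟧ e t)) q , Sat-ren⁺ (≗-lift x e) φ p

  v₀ : ∀ {n} → Term (1 ℕ.+ n)
  v₀ = var zero
  v₁ : ∀ {n} → Term (2 ℕ.+ n)
  v₁ = var (suc zero)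
  v₂ : ∀ {n} → Term (3 ℕ.+ n)
  v₂ = var (suc (suc zero))
  v₃ : ∀ {n} → Term (4 ℕ.+ n)
  v₃ = var (suc (suc (suc zero)))
  v₄ : ∀ {n} → Term (5 ℕ.+ n)
  v₄ = var (suc (suc (suc (suc zero))))
  v₅ : ∀ {n} → Term (6 ℕ.+ n)
  v₅ = var (suc (suc (suc (suc (suc zero)))))
  v₆ : ∀ {n} → Term (7 ℕ.+ n)
  v₆ = var (suc (suc (suc (suc (suc (suc zero))))))
  v₇ : ∀ {n} → Term (8 ℕ.+ n)
  v₇ = var (suc (suc (suc (suc (suc (suc (suc zero)))))))

  v₈ : ∀ {n} → Term (9 ℕ.+ n)
  v₈ = var (suc (suc (suc (suc (suc (suc (suc (suc zero))))))))
  v₉ : ∀ {n} → Term (10 ℕ.+ n)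
  v₉ = var (suc (suc (suc (suc (suc (suc (suc (suc (suc zero)))))))))

  wk : ∀ {n} → Term n → Term (suc n)
  wk = renᵗ suc

  `¬ : ∀ {n} → Formula n → Formula n
  `¬ φ = φ `⇒ `⊥

  keep₁ : ∀ {n} → Fin (suc n) → Fin (suc (suc n))
  keep₁ = liftᵣ suc

  keep₁-≗ : ∀ {n} {ρ : Env n} {x y} → (x ∷ ρ) ≗[ keep₁ ] (x ∷ (y ∷ ρ))
  keep₁-≗ {x = x} = ≗-lift x (λ i → refl)

  -- By contradiction: without a least solution, induction on y shows that no z below y satisfies
  -- `φ`, for every y.
  least : ∀ {n} (φ : Formula (suc n)) (ρ : Env n) x → Sat φ (x ∷ ρ) →
    Σ Carrier λ y → Sat φ (y ∷ ρ) × (∀ z → z ≺ y → ¬ Sat φ (z ∷ ρ))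
  least {n} φ ρ x p with em {Σ Carrier λ y → Sat φ (y ∷ ρ) × (∀ z → z ≺ y → ¬ Sat φ (z ∷ ρ))}
  ... | yes q = q
  ... | no no-least = ⊥-elim (none-below (x ⊕ I) x (x≺x⊕I x) (Sat-ren⁺ keep₁-≗ φ p))
    where
    below : Formula (suc n)
    below = `∀< v₀ (`¬ (ren keep₁ φ))

    none-below : ∀ y → Sat below (y ∷ ρ)
    none-below = induction below ρ (λ z q → ⊥-elim (⊀O q)) step
      where
      step : ∀ y → Sat below (y ∷ ρ) → Sat below ((y ⊕ I) ∷ ρ)
      step y ih z q r with ≺suc⇒≼ q
      ... | inj₁ z≺y = ih z z≺y (Sat-ren⁺ keep₁-≗ φ (Sat-ren⁻ keep₁-≗ φ r))
      ... | inj₂ refl = no-least (z , Sat-ren⁻ keep₁-≗ φ r ,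
                          λ w w≺z s → ih w w≺z (Sat-ren⁺ keep₁-≗ φ s))

  Nonstandard : Carrier → Set
  Nonstandard x = ∀ n → num n ≺ x

  -- If ν is a counterexample, there is a least one. It is not 0, so it has a predecessor, which
  -- satisfies `φ`; were that predecessor standard, the counterexample would be standard too.
  overspill : ∀ {n} (φ : Formula (suc n)) (ρ : Env n) ν → Nonstandard ν →
    (∀ k → Sat φ (num k ∷ ρ)) → Σ Carrier λ x → Nonstandard x × Sat φ (x ∷ ρ)
  overspill φ ρ ν ν-ns φ-std with em {Sat φ (ν ∷ ρ)}
  ... | yes p = ν , ν-ns , p
  ... | no p with least (`¬ φ) ρ ν p
  ...   | y , ¬φy , φ-below with zero-or-suc y
  ...     | inj₁ refl = ⊥-elim (¬φy (φ-std 0))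
  ...     | inj₂ (x , refl) = x , x-ns , φx
    where
    φx : Sat φ (x ∷ ρ)
    φx with em {Sat φ (x ∷ ρ)}
    ... | yes q = q
    ... | no q = ⊥-elim (φ-below x (x≺x⊕I x) q)

    x-ns : Nonstandard x
    x-ns n with ≼-or-≻ x (num n)
    ... | inj₂ q = q
    ... | inj₁ q with ≺num⇒standard (suc n) (≼⇒≺suc q)
    ...   | k , _ , refl = ⊥-elim (¬φy (φ-std (suc k)))

  opaque
    division : ∀ m u → Σ Carrier λ q → Σ Carrier λ x → (u ≡ (q ⊗ (m ⊕ I)) ⊕ x) × x ≺ (m ⊕ I)
    division m = induction φ (m ∷ λ ())
      (O , O , solve 1 (λ m → con 0 := con 0 :* (m :+ con 1) :+ con 0) refl m , O≺suc m) step
      where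
      φ : Formula 2
      φ = `∃ (`∃ ((v₂ `≡ ((v₁ `* (v₃ `+ `1)) `+ v₀)) `∧ (v₀ `< (v₃ `+ `1))))

      step : ∀ u → Sat φ (u ∷ (m ∷ λ ())) → Sat φ ((u ⊕ I) ∷ (m ∷ λ ()))
      step u (q , x , refl , p) with ≺suc⇒≼ p
      ... | inj₁ x≺m = q , x ⊕ I ,
            solve 3 (λ q m x → q :* m :+ x :+ con 1 := q :* m :+ (x :+ con 1)) refl q (m ⊕ I) x ,
            suc-≺ x≺m
      ... | inj₂ refl = q ⊕ I , O ,
            solve 2 (λ q m → q :* (m :+ con 1) :+ m :+ con 1 := (q :+ con 1) :* (m :+ con 1) :+ con 0)
              refl q m ,
            O≺suc m

  -- Pairing and the β-function

  Pair : Carrier → Carrier → Carrier → Set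
  Pair u v a = (((u ⊕ v) ⊗ ((u ⊕ v) ⊕ I)) ⊕ (u ⊕ u)) ≡ (a ⊕ a)

  `Pair : ∀ {n} → Term n → Term n → Term n → Formula n
  `Pair u v a = (((u `+ v) `* ((u `+ v) `+ `1)) `+ (u `+ u)) `≡ (a `+ a)

  opaque
    -- With w the smaller sum, u ≤ w keeps w(w + 1) + 2u below (w + 1)(w + 2). The term supplied to
    -- `≺-by` is the explicit difference, less one.
    Pair-sum-≮ : ∀ {u v u′ v′ a} → Pair u v a → Pair u′ v′ a → ¬ ((u ⊕ v) ≺ (u′ ⊕ v′))
    Pair-sum-≮ {u} {v} {u′} {v′} p q r with ≺⇒∃ r
    ... | z , e = <-irrefl _ (subst₂ _≺_ p (trans (cong (λ w → (w ⊗ (w ⊕ I)) ⊕ (u′ ⊕ u′)) e) q)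
      (≺-by ((((v ⊕ v) ⊕ I) ⊕ (z ⊗ ((((u ⊕ v) ⊕ (u ⊕ v)) ⊕ z) ⊕ ((I ⊕ I) ⊕ I)))) ⊕ (u′ ⊕ u′))
        (solve 4 (λ u v z u′ →
           (u :+ v) :* (u :+ v :+ con 1) :+ (u :+ u) :+ con 1
             :+ (v :+ v :+ con 1 :+ z :* (u :+ v :+ (u :+ v) :+ z :+ (con 1 :+ con 1 :+ con 1)) :+ (u′ :+ u′))
           := (u :+ v :+ con 1 :+ z) :* (u :+ v :+ con 1 :+ z :+ con 1) :+ (u′ :+ u′))
           refl u v z u′)))

    Pair-injective : ∀ {u v u′ v′ a} → Pair u v a → Pair u′ v′ a → u ≡ u′ × v ≡ v′
    Pair-injective {u} {v} {u′} {v′} {a} p q with <-trichotomy (u ⊕ v) (u′ ⊕ v′)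
    ... | inj₁ r = ⊥-elim (Pair-sum-≮ {u} {v} {u′} {v′} {a} p q r)
    ... | inj₂ (inj₂ r) = ⊥-elim (Pair-sum-≮ {u′} {v′} {u} {v} {a} q p r)
    ... | inj₂ (inj₁ e) = u≡u′ , ⊕-cancelˡ u (trans e (cong (_⊕ v′) (sym u≡u′)))
      where
      u≡u′ : u ≡ u′
      u≡u′ = double-injective (⊕-cancelˡ ((u ⊕ v) ⊗ ((u ⊕ v) ⊕ I))
        (trans p (trans (sym q) (cong (λ w → (w ⊗ (w ⊕ I)) ⊕ (u′ ⊕ u′)) (sym e)))))

    -- Induction walks along the antidiagonals: (u + 1, w) follows (u, w + 1), and (0, u + 1)
    -- follows (u, 0).
    unpair : ∀ a → Σ Carrier λ u → Σ Carrier λ v → Pair u v a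
    unpair = induction φ (λ ())
      (O , O , solve 0 ((con 0 :+ con 0) :* (con 0 :+ con 0 :+ con 1) :+ (con 0 :+ con 0)
                         := con 0 :+ con 0) refl)
      step
      where
      φ : Formula 1
      φ = `∃ (`∃ (`Pair v₁ v₀ v₂))

      step : ∀ a → Sat φ (a ∷ λ ()) → Sat φ ((a ⊕ I) ∷ λ ())
      step a (u , v , p) with zero-or-suc v
      ... | inj₂ (w , refl) = u ⊕ I , w , trans
            (solve 2 (λ u w → (u :+ con 1 :+ w) :* (u :+ con 1 :+ w :+ con 1) :+ (u :+ con 1 :+ (u :+ con 1))
                := (u :+ (w :+ con 1)) :* (u :+ (w :+ con 1) :+ con 1) :+ (u :+ u) :+ (con 1 :+ con 1))
              refl u w)
            (trans (cong (_⊕ (I ⊕ I)) p)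
              (solve 1 (λ a → a :+ a :+ (con 1 :+ con 1) := a :+ con 1 :+ (a :+ con 1)) refl a))
      ... | inj₁ refl = O , u ⊕ I , trans
            (solve 1 (λ u → (con 0 :+ (u :+ con 1)) :* (con 0 :+ (u :+ con 1) :+ con 1) :+ (con 0 :+ con 0)
                := (u :+ con 0) :* (u :+ con 0 :+ con 1) :+ (u :+ u) :+ (con 1 :+ con 1))
              refl u)
            (trans (cong (_⊕ (I ⊕ I)) p)
              (solve 1 (λ a → a :+ a :+ (con 1 :+ con 1) := a :+ con 1 :+ (a :+ con 1)) refl a))

    -- `Pair` describes 2a rather than a, so `pair` has to halve x(x + 1).
    triangular : ∀ x → Σ Carrier λ h → x ⊗ (x ⊕ I) ≡ h ⊕ h
    triangular = induction φ (λ ())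
      (O , solve 0 (con 0 :* (con 0 :+ con 1) := con 0 :+ con 0) refl)
      λ x → λ { (h , e) → h ⊕ (x ⊕ I) , trans
        (solve 1 (λ x → (x :+ con 1) :* (x :+ con 1 :+ con 1)
           := x :* (x :+ con 1) :+ (x :+ con 1 :+ (x :+ con 1))) refl x)
        (trans (cong (_⊕ ((x ⊕ I) ⊕ (x ⊕ I))) e)
          (solve 2 (λ h x → h :+ h :+ (x :+ x) := h :+ x :+ (h :+ x)) refl h (x ⊕ I))) }
      where
      φ : Formula 1
      φ = `∃ ((v₁ `* (v₁ `+ `1)) `≡ (v₀ `+ v₀))

    pair : ∀ u v → Σ Carrier λ a → Pair u v a
    pair u v with triangular (u ⊕ v)
    ... | h , e = h ⊕ u , trans (cong (_⊕ (u ⊕ u)) e)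
      (solve 2 (λ h u → h :+ h :+ (u :+ u) := h :+ u :+ (h :+ u)) refl h u)

    half-≼ : ∀ {x y} → (x ⊕ x) ≼ (y ⊕ y) → x ≼ y
    half-≼ {x} {y} p with ≼-or-≻ x y
    ... | inj₁ q = q
    ... | inj₂ q = ⊥-elim (≼⇒⊁ p (≺-≼-trans (+-mono-< y x y q) (⊕-mono-≼ ≼-refl (inj₁ q))))

    -- The sum w satisfies 2w ≤ w(w + 1), whether w is 0 or a successor. The resulting bounds on the
    -- components later bound quantifiers and make the arguments of an index smaller than the index.
    Pair-sum-≼ : ∀ {u v a} → Pair u v a → (u ⊕ v) ≼ a
    Pair-sum-≼ {u} {v} {a} p = half-≼ (subst ((w ⊕ w) ≼_) p (≼-trans (2w≼ (zero-or-suc w)) (x≼x⊕y _ _)))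
      where
      w : Carrier
      w = u ⊕ v

      2w≼ : (w ≡ O) ⊎ (Σ Carrier λ y → w ≡ y ⊕ I) → (w ⊕ w) ≼ (w ⊗ (w ⊕ I))
      2w≼ (inj₁ e) rewrite e = inj₂ (solve 0 (con 0 :+ con 0 := con 0 :* (con 0 :+ con 1)) refl)
      2w≼ (inj₂ (y , e)) rewrite e = ≼-by (y ⊗ (y ⊕ I))
        (solve 1 (λ y → y :+ con 1 :+ (y :+ con 1) :+ y :* (y :+ con 1)
                         := (y :+ con 1) :* (y :+ con 1 :+ con 1)) refl y)

    Pair-≼ˡ : ∀ {u v a} → Pair u v a → u ≼ a
    Pair-≼ˡ {u} {v} p = ≼-trans (x≼x⊕y u v) (Pair-sum-≼ {u} {v} p)

    Pair-≼ʳ : ∀ {u v a} → Pair u v a → v ≼ a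
    Pair-≼ʳ {u} {v} p = ≼-trans (x≼y⊕x v u) (Pair-sum-≼ {u} {v} p)

  modulus : Carrier → Carrier → Carrier
  modulus v i = I ⊕ ((i ⊕ I) ⊗ v)

  -- Elem a n x is Beta a (num n) x.
  Beta : Carrier → Carrier → Carrier → Set
  Beta a i x = Σ Carrier λ u → Σ Carrier λ v →
    Pair u v a × (Σ Carrier λ q → u ≡ (q ⊗ modulus v i) ⊕ x) × x ≺ modulus v i

  `modulus : ∀ {n} → Term n → Term n → Term n
  `modulus v i = `1 `+ ((i `+ `1) `* v)

  `Beta : ∀ {n} → Term n → Term n → Term n → Formula n
  `Beta a i x = `∃ (`∃ (`Pair v₁ v₀ (wk (wk a)) `∧
    ((`∃ (v₂ `≡ ((v₀ `* `modulus v₁ (wk (wk (wk i)))) `+ wk (wk (wk x))))) `∧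
     (wk (wk x) `< `modulus v₀ (wk (wk i))))))

  opaque
    remainder : ∀ v i u → Σ Carrier λ x → (Σ Carrier λ q → u ≡ (q ⊗ modulus v i) ⊕ x) × x ≺ modulus v i
    remainder v i u with division ((i ⊕ I) ⊗ v) u
    ... | q , x , e , p rewrite +-comm ((i ⊕ I) ⊗ v) I = x , (q , e) , p

    Beta-total : ∀ a i → Σ Carrier (Beta a i)
    Beta-total a i with unpair a
    ... | u , v , p with remainder v i u
    ...   | x , r = x , u , v , p , r

    Beta-functional : ∀ {a i x y} → Beta a i x → Beta a i y → x ≡ y
    Beta-functional (u , v , p , (q , e) , r) (u′ , v′ , p′ , (q′ , e′) , r′)
      with Pair-injective {u} {v} {u′} {v′} p p′
    ... | refl , refl = proj₂ (division-unique {q = q} {q′ = q′} r r′ (trans (sym e) e′))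

    β : Carrier → Carrier → Carrier
    β a i = proj₁ (Beta-total a i)

    β-spec : ∀ a i → Beta a i (β a i)
    β-spec a i = proj₂ (Beta-total a i)

    β-unique : ∀ {a i x} → Beta a i x → β a i ≡ x
    β-unique p = Beta-functional (β-spec _ _) p

    Beta⁺ : ∀ {a i x} → β a i ≡ x → Beta a i x
    Beta⁺ {a} {i} refl = β-spec a i

    Beta-≼ : ∀ {a i x} → Beta a i x → x ≼ a
    Beta-≼ {x = x} (u , v , p , (q , e) , _) =
      ≼-trans (subst (x ≼_) (sym e) (x≼y⊕x x _)) (Pair-≼ˡ {u} {v} p)

    β-≼ : ∀ a i → β a i ≼ a
    β-≼ a i = Beta-≼ (β-spec a i)

  -- The Chinese remainder theorem

  opaque
    -- W plays the role of n!: the step multiplies by n + 1. Divisibility by all small differences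
    -- of indices is what makes the moduli of the β-function coprime.
    commonMultiple : ∀ n → Σ Carrier λ W → O ≺ W ×
      (∀ g → g ≺ (n ⊕ I) → O ≺ g → Σ Carrier λ w → g ⊗ w ≡ W)
    commonMultiple = induction φ (λ ())
      (I , 0<1 , λ g g≺1 O≺g → ⊥-elim (≼⇒⊁ (≺⇒sucˡ≼ O≺g) g≺1)) step
      where
      φ : Formula 1
      φ = `∃ ((`0 `< v₀) `∧ `∀< (v₁ `+ `1) ((`0 `< v₀) `⇒ `∃ ((v₁ `* v₀) `≡ v₂)))

      step : ∀ n → Sat φ (n ∷ λ ()) → Sat φ ((n ⊕ I) ∷ λ ())
      step n (W , W>0 , div) =
        W ⊗ (n ⊕ I) , ≢O⇒O≺ (⊗-nonzero (O≺⇒≢O W>0) suc≢O) , div′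
        where
        div′ : ∀ g → g ≺ ((n ⊕ I) ⊕ I) → O ≺ g → Σ Carrier λ w → g ⊗ w ≡ W ⊗ (n ⊕ I)
        div′ g p O≺g with ≺suc⇒≼ p
        ... | inj₂ refl = W , *-comm _ _
        ... | inj₁ q with div g q O≺g
        ...   | w , refl = w ⊗ (n ⊕ I) , sym (*-assoc _ _ _)

  -- Stated with a multiple of m on both sides to avoid subtraction.
  Invertible : Carrier → Carrier → Set
  Invertible p m = Σ Carrier λ w → Σ Carrier λ c → Σ Carrier λ d →
    (p ⊗ w) ⊕ (c ⊗ m) ≡ (d ⊗ m) ⊕ I

  `Invertible : ∀ {n} → Term n → Term n → Formula n
  `Invertible p m = `∃ (`∃ (`∃
    (((wk (wk (wk p)) `* v₂) `+ (v₁ `* wk (wk (wk m)))) `≡ ((v₀ `* wk (wk (wk m))) `+ `1))))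

  opaque
    Invertible-I : ∀ m → Invertible I m
    Invertible-I m = I , O , O ,
      solve 1 (λ m → con 1 :* con 1 :+ con 0 :* m := con 0 :* m :+ con 1) refl m

    Invertible-⊗ : ∀ {p p′ m} → Invertible p m → Invertible p′ m → Invertible (p ⊗ p′) m
    Invertible-⊗ {p} {p′} {m} (w , c , d , e) (w′ , c′ , d′ , e′) =
      w ⊗ w′ ,
      ((((p ⊗ w) ⊗ c′) ⊕ (c ⊗ (p′ ⊗ w′))) ⊕ ((c ⊗ c′) ⊗ m)) ,
      ((((d ⊗ d′) ⊗ m) ⊕ d) ⊕ d′) ,
      trans
        (solve 7 (λ p p′ m w w′ c c′ →
           p :* p′ :* (w :* w′) :+ (p :* w :* c′ :+ c :* (p′ :* w′) :+ c :* c′ :* m) :* m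
             := (p :* w :+ c :* m) :* (p′ :* w′ :+ c′ :* m))
          refl p p′ m w w′ c c′)
        (trans (cong₂ _⊗_ e e′)
          (solve 3 (λ m d d′ → (d :* m :+ con 1) :* (d′ :* m :+ con 1)
             := (d :* d′ :* m :+ d :+ d′) :* m :+ con 1) refl m d d′))

    -- Modulo 1 + n with n = (k + g + 1) g w one has n ≡ -1 and, for
    -- E = w (k + g + 1)², also (1 + (k + 1) g w) E ≡ -n² ≡ -1; so E n is an inverse.
    modulus-invertible : ∀ k g w → Invertible (modulus (g ⊗ w) k) (modulus (g ⊗ w) (k ⊕ g))
    modulus-invertible k g w =
      E ⊗ n , (n ⊗ n) ⊕ I , (n ⊗ E) ⊕ n ,
      trans (cong (_⊕ (((n ⊗ n) ⊕ I) ⊗ (I ⊕ n))) (sym (*-assoc _ _ _)))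
        (trans
          (solve 2 (λ A n → A :* n :+ (n :* n :+ con 1) :* (con 1 :+ n)
                      := (A :+ n :* n) :* n :+ (n :* n :+ n :+ con 1)) refl (modulus (g ⊗ w) k ⊗ E) n)
          (trans (cong (λ z → (z ⊗ n) ⊕ (((n ⊗ n) ⊕ n) ⊕ I)) A+n²)
            (solve 2 (λ n E → (con 1 :+ n) :* E :* n :+ (n :* n :+ n :+ con 1)
                        := (n :* E :+ n) :* (con 1 :+ n) :+ con 1) refl n E)))
      where
      j n E : Carrier
      j = (k ⊕ g) ⊕ I
      n = j ⊗ (g ⊗ w)
      E = w ⊗ (j ⊗ j)

      A+n² : (modulus (g ⊗ w) k ⊗ E) ⊕ (n ⊗ n) ≡ (I ⊕ n) ⊗ E
      A+n² = solve 3 (λ k g w → let j = k :+ g :+ con 1 in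
        (con 1 :+ (k :+ con 1) :* (g :* w)) :* (w :* (j :* j)) :+ j :* (g :* w) :* (j :* (g :* w))
          := (con 1 :+ j :* (g :* w)) :* (w :* (j :* j))) refl k g w

    -- With m = n + 1, the number y = x + nu is congruent to x - u modulo m, and w inverts p, so t =
    -- wy yields u + pt ≡ x. Multiples of m are added on both sides until `division-unique` can
    -- compare remainders.
    solve-congruence : ∀ {p} v i x u → Invertible p (modulus v i) → x ≺ modulus v i →
      Σ Carrier λ t → Σ Carrier λ q → u ⊕ (p ⊗ t) ≡ (q ⊗ modulus v i) ⊕ x
    solve-congruence {p} v i x u (w , c , d , e) x≺m with remainder v i (u ⊕ (p ⊗ (w ⊗ (x ⊕ (((i ⊕ I) ⊗ v) ⊗ u)))))
    ... | x′ , (q , e′) , x′≺m = w ⊗ y , q , trans e′ (cong ((q ⊗ m) ⊕_) (sym x≡x′))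
      where
      m n y : Carrier
      m = modulus v i
      n = (i ⊕ I) ⊗ v
      y = x ⊕ (n ⊗ u)

      x≡x′ : x ≡ x′
      x≡x′ = proj₂ (division-unique {q = (d ⊗ y) ⊕ u} {q′ = q ⊕ (c ⊗ y)} x≺m x′≺m
        (trans
          (solve 4 (λ d x n u → (d :* (x :+ n :* u) :+ u) :* (con 1 :+ n) :+ x
              := u :+ (d :* (con 1 :+ n) :+ con 1) :* (x :+ n :* u)) refl d x n u)
          (trans (cong (λ z → u ⊕ (z ⊗ y)) (sym e))
            (trans
              (solve 6 (λ u p w c m y → u :+ (p :* w :+ c :* m) :* y
                  := u :+ p :* (w :* y) :+ c :* y :* m) refl u p w c m y)
              (trans (cong (_⊕ ((c ⊗ y) ⊗ m)) e′)
                (solve 5 (λ q m x c y → q :* m :+ x :+ c :* y :* m := (q :+ c :* y) :* m :+ x)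
                  refl q m x′ c y))))))

    ≺-modulus : ∀ {x v} i → x ≺ v → x ≺ modulus v i
    ≺-modulus {x} {v} i p = ≺-≼-trans p (≼-by (I ⊕ (i ⊗ v))
      (solve 2 (λ v i → v :+ (con 1 :+ i :* v) := con 1 :+ (i :+ con 1) :* v) refl v i))

    congruent-shift : ∀ {u p m x} t → (Σ Carrier λ q → u ≡ (q ⊗ m) ⊕ x) → (Σ Carrier λ q → p ≡ q ⊗ m) →
      Σ Carrier λ q → u ⊕ (p ⊗ t) ≡ (q ⊗ m) ⊕ x
    congruent-shift {m = m} {x} t (q , refl) (q′ , refl) = q ⊕ (q′ ⊗ t) ,
      solve 5 (λ q m x q′ t → q :* m :+ x :+ q′ :* m :* t := (q :+ q′ :* t) :* m :+ x) refl q m x q′ t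

  opaque
    -- All entries are encoded afresh with a second component V that is divisible by every positive
    -- g ≤ N, so that the moduli of index at most N are pairwise coprime, and that exceeds a + y,
    -- hence every value to be stored. The Chinese remainder theorem then supplies the first
    -- component.
    append : ∀ a N y → Σ Carrier λ a′ → (∀ i → i ≺ N → β a′ i ≡ β a i) × β a′ N ≡ y
    append a N y with commonMultiple N
    ... | W , W>0 , W-div = result (crt N ≼-refl)
      where
      V : Carrier
      V = W ⊗ ((a ⊕ y) ⊕ I)

      V-div : ∀ g → g ≺ (N ⊕ I) → O ≺ g → Σ Carrier λ w → g ⊗ w ≡ V
      V-div g p q with W-div g p q
      ... | w , refl = w ⊗ ((a ⊕ y) ⊕ I) , sym (*-assoc _ _ _)

      a⊕y≺V : (a ⊕ y) ≺ V
      a⊕y≺V with ≺⇒∃ W>0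
      ... | z , refl = ≺-by (z ⊗ ((a ⊕ y) ⊕ I))
        (solve 2 (λ z s → s :+ z :* s := (con 0 :+ con 1 :+ z) :* s) refl z ((a ⊕ y) ⊕ I))

      -- Here u solves the first k congruences, p is a common multiple of their moduli, and p is
      -- invertible modulo each later one; so adding a multiple of p corrects u at index k without
      -- disturbing the earlier indices. The guard `k ≼ N` belongs to the induction formula because
      -- the moduli are controlled only up to N.
      CRT : Carrier → Set
      CRT k = k ≼ N → Σ Carrier λ u → Σ Carrier λ p →
        (∀ i → i ≺ k → (Σ Carrier λ x → Beta a i x × Σ Carrier λ q → u ≡ (q ⊗ modulus V i) ⊕ x) ×
                        (Σ Carrier λ q → p ≡ q ⊗ modulus V i)) ×
        (∀ j → j ≺ (N ⊕ I) → ¬ (j ≺ k) → Invertible p (modulus V j))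

      φ : Formula 4
      φ = ((v₀ `< v₂) `∨ (v₀ `≡ v₂)) `⇒ `∃ (`∃
        (`∀< v₂ ((`∃ (`Beta v₅ v₁ v₀ `∧ `∃ (v₄ `≡ ((v₀ `* `modulus v₈ v₂) `+ v₁)))) `∧
                 (`∃ (v₂ `≡ (v₀ `* `modulus v₇ v₁)))) `∧
         (`∀< (v₄ `+ `1) (`¬ (v₀ `< v₃) `⇒ `Invertible v₁ (`modulus v₆ v₀)))))

      crt : ∀ k → CRT k
      crt = induction φ (a ∷ (N ∷ (V ∷ λ ())))
        (λ _ → O , I , (λ i p → ⊥-elim (⊀O p)) , λ j _ _ → Invertible-I _) step
        where
        step : ∀ k → CRT k → CRT (k ⊕ I)
        step k ih k+1≼N with ih (≼-trans (inj₁ (x≺x⊕I k)) k+1≼N)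
        ... | u , p , cong-u , inv
          with solve-congruence V k (β a k) u
                 (inv k (≼-≺-trans (inj₁ (x≺x⊕I k)) (≼⇒≺suc k+1≼N)) (<-irrefl k))
                 (≺-modulus k (≼-≺-trans (≼-trans (β-≼ a k) (x≼x⊕y a y)) a⊕y≺V))
        ... | t , q , e = u ⊕ (p ⊗ t) , p ⊗ modulus V k , cong-u′ , inv′
          where
          cong-u′ : ∀ i → i ≺ (k ⊕ I) →
            (Σ Carrier λ x → Beta a i x × Σ Carrier λ q → u ⊕ (p ⊗ t) ≡ (q ⊗ modulus V i) ⊕ x) ×
            (Σ Carrier λ q → p ⊗ modulus V k ≡ q ⊗ modulus V i)
          cong-u′ i i≺k+1 with ≺suc⇒≼ i≺k+1
          ... | inj₂ refl = (β a i , β-spec a i , q , e) , p , refl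
          ... | inj₁ i≺k with cong-u i i≺k
          ...   | (x , b , c) , (q , refl) = (x , b , congruent-shift t c (q , refl)) ,
                  q ⊗ modulus V k ,
                  solve 3 (λ q m m′ → q :* m :* m′ := q :* m′ :* m) refl q (modulus V i) (modulus V k)

          inv′ : ∀ j → j ≺ (N ⊕ I) → ¬ (j ≺ (k ⊕ I)) → Invertible (p ⊗ modulus V k) (modulus V j)
          inv′ j j≺ j⊀k+1 with ≺⇒∃ (sucˡ≼⇒≺ (⊀⇒≽ j⊀k+1))
          -- The later index is k + (1 + z); the difference 1 + z is at most N, so it divides V and
          -- `modulus-invertible` applies.
          ... | z , refl with V-div (I ⊕ z)
                                (≼-≺-trans (≼-by k (solve 2 (λ k z → con 1 :+ z :+ k := k :+ con 1 :+ z) refl k z)) j≺)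
                                (≺-≼-trans 0<1 (x≼x⊕y I z))
          ...   | w , g⊗w≡V = Invertible-⊗ {p} {modulus V k}
                    (inv _ j≺ λ r → j⊀k+1 (<-trans _ _ _ r (x≺x⊕I k)))
                    (subst₂ (λ V j → Invertible (modulus V k) (modulus V j)) g⊗w≡V (sym (+-assoc k I z))
                      (modulus-invertible k (I ⊕ z) w))

      result : (Σ Carrier λ u → Σ Carrier λ p →
          (∀ i → i ≺ N → (Σ Carrier λ x → Beta a i x × Σ Carrier λ q → u ≡ (q ⊗ modulus V i) ⊕ x) ×
                          (Σ Carrier λ q → p ≡ q ⊗ modulus V i)) ×
          (∀ j → j ≺ (N ⊕ I) → ¬ (j ≺ N) → Invertible p (modulus V j))) →
        Σ Carrier λ a′ → (∀ i → i ≺ N → β a′ i ≡ β a i) × β a′ N ≡ y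
      result (u , p , cong-u , inv)
        with solve-congruence V N y u (inv N (x≺x⊕I N) (<-irrefl N)) y≺m
        where
        y≺m : y ≺ modulus V N
        y≺m = ≺-modulus N (≼-≺-trans (x≼y⊕x y a) a⊕y≺V)
      ... | t , q , e with pair (u ⊕ (p ⊗ t)) V
      ...   | a′ , pa′ = a′ , agree ,
                β-unique (_ , V , pa′ , (q , e) , ≺-modulus N (≼-≺-trans (x≼y⊕x y a) a⊕y≺V))
        where
        agree : ∀ i → i ≺ N → β a′ i ≡ β a i
        agree i i≺N with cong-u i i≺N
        ... | (x , b , c) , d = trans
          (β-unique (_ , V , pa′ , congruent-shift t c d ,
            ≺-modulus i (≼-≺-trans (≼-trans (Beta-≼ b) (x≼x⊕y a y)) a⊕y≺V)))
          (sym (β-unique b))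

  -- Coded recursion

  AgreeBelow : Carrier → Carrier → Carrier → Set
  AgreeBelow m s s′ = ∀ i → i ≺ m → β s′ i ≡ β s i

  keep₂ : ∀ {n} → Fin (suc (suc n)) → Fin (suc (suc (suc n)))
  keep₂ = liftᵣ (liftᵣ suc)

  keep₂-≗ : ∀ {n} {ρ : Env n} {x y z} → (x ∷ (y ∷ ρ)) ≗[ keep₂ ] (x ∷ (y ∷ (z ∷ ρ)))
  keep₂-≗ {x = x} {y} = ≗-lift x (≗-lift y (λ i → refl))

  opaque
    -- Course-of-values recursion: Sat φ (m ∷ (s ∷ ρ)) constrains the m-th entry of the sequence s
    -- in terms of the previous ones.
    buildSequence : ∀ {n} (φ : Formula (suc (suc n))) (ρ : Env n) →
      (∀ s s′ m → AgreeBelow (m ⊕ I) s s′ → Sat φ (m ∷ (s ∷ ρ)) → Sat φ (m ∷ (s′ ∷ ρ))) →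
      (∀ s m → Σ Carrier λ y → ∀ s′ → AgreeBelow m s s′ → β s′ m ≡ y → Sat φ (m ∷ (s′ ∷ ρ))) →
      ∀ N → Σ Carrier λ s → ∀ m → m ≺ N → Sat φ (m ∷ (s ∷ ρ))
    buildSequence {n} φ ρ local extend N = let s , p = built N in s , λ m q → Sat-ren⁻ keep₂-≗ φ (p m q)
      where
      ψ : Formula (suc n)
      ψ = `∃ (`∀< v₁ (ren keep₂ φ))

      built : ∀ N → Sat ψ (N ∷ ρ)
      built = induction ψ ρ (O , λ m p → ⊥-elim (⊀O p)) step
        where
        step : ∀ N → Sat ψ (N ∷ ρ) → Sat ψ ((N ⊕ I) ∷ ρ)
        step N (s , p) with extend s N
        ... | y , ext with append s N y
        ...   | s′ , agree , e = s′ , holds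
          where
          holds : ∀ m → m ≺ (N ⊕ I) → Sat (ren keep₂ φ) (m ∷ (s′ ∷ ((N ⊕ I) ∷ ρ)))
          holds m q with ≺suc⇒≼ q
          ... | inj₂ refl = Sat-ren⁺ keep₂-≗ φ (ext s′ agree e)
          ... | inj₁ m≺N = Sat-ren⁺ keep₂-≗ φ
                (local s s′ m (λ i r → agree i (≼-≺-trans (≺suc⇒≼ r) m≺N)) (Sat-ren⁻ keep₂-≗ φ (p m m≺N)))

    -- The case of `buildSequence` in which entry i is constrained independently of the others.
    -- Since entries are appended one at a time, mere existence of a value at each index gives a
    -- coded choice of values.
    comprehension : ∀ {n} (φ : Formula (suc (suc n))) (ρ : Env n) →
      (∀ i → Σ Carrier λ x → Sat φ (x ∷ (i ∷ ρ))) →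
      ∀ N → Σ Carrier λ s → ∀ i → i ≺ N → Sat φ (β s i ∷ (i ∷ ρ))
    comprehension {n} φ ρ total N =
      let s , p = buildSequence ψ ρ local extend N in s , λ m q → sem⁻ s m (p m q)
      where
      ψ : Formula (suc (suc n))
      ψ = `∃ (`Beta v₂ v₁ v₀ `∧ ren keep₂ φ)

      sem⁺ : ∀ s m → Sat φ (β s m ∷ (m ∷ ρ)) → Sat ψ (m ∷ (s ∷ ρ))
      sem⁺ s m p = β s m , β-spec s m , Sat-ren⁺ keep₂-≗ φ p

      sem⁻ : ∀ s m → Sat ψ (m ∷ (s ∷ ρ)) → Sat φ (β s m ∷ (m ∷ ρ))
      sem⁻ s m (x , b , p) =
        subst (λ x → Sat φ (x ∷ (m ∷ ρ))) (sym (β-unique b)) (Sat-ren⁻ keep₂-≗ φ p)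

      local : ∀ s s′ m → AgreeBelow (m ⊕ I) s s′ → Sat ψ (m ∷ (s ∷ ρ)) → Sat ψ (m ∷ (s′ ∷ ρ))
      local s s′ m agree p = sem⁺ s′ m
        (subst (λ x → Sat φ (x ∷ (m ∷ ρ))) (sym (agree m (x≺x⊕I m))) (sem⁻ s m p))

      extend : ∀ s m → Σ Carrier λ y → ∀ s′ → AgreeBelow m s s′ → β s′ m ≡ y → Sat ψ (m ∷ (s′ ∷ ρ))
      extend s m = let x , p = total m in
        x , λ s′ _ e → sem⁺ s′ m (subst (λ x → Sat φ (x ∷ (m ∷ ρ))) (sym e) p)

    recursion : ∀ {n} (φ : Formula (suc (suc (suc n)))) (ρ : Env n) →
      (∀ x i → Σ Carrier λ y → Sat φ (y ∷ (x ∷ (i ∷ ρ)))) →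
      ∀ x₀ N → Σ Carrier λ s → β s O ≡ x₀ ×
        (∀ i → i ≺ N → Sat φ (β s (i ⊕ I) ∷ (β s i ∷ (i ∷ ρ))))
    recursion {n} φ ρ total x₀ N =
      -- Length N + 1, because the step at i ≺ N speaks of entry i + 1.
      let s , p = buildSequence ψ (x₀ ∷ ρ) local extend (N ⊕ I) in
      s , proj₁ (sem⁻ s O (p O (O≺suc N))) refl ,
      λ i q → proj₂ (sem⁻ s (i ⊕ I) (p (i ⊕ I) (suc-≺ q))) i refl
      where
      f : Fin (suc (suc (suc n))) → Fin (suc (suc (suc (suc (suc (suc n))))))
      f = liftᵣ (liftᵣ (liftᵣ (λ i → suc (suc (suc i)))))

      f-≗ : ∀ {x y z a b c} →
        (x ∷ (y ∷ (z ∷ ρ))) ≗[ f ] (x ∷ (y ∷ (z ∷ (a ∷ (b ∷ (c ∷ ρ))))))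
      f-≗ {x} {y} {z} = ≗-lift x (≗-lift y (≗-lift z (λ i → refl)))

      ψ : Formula (suc (suc (suc n)))
      ψ = ((v₀ `≡ `0) `⇒ `Beta v₁ v₀ v₂) `∧
          `∀ ((v₁ `≡ (v₀ `+ `1)) `⇒ `∃ (`∃ (`Beta v₄ v₂ v₁ `∧ (`Beta v₄ v₃ v₀ `∧ ren f φ))))

      Step : Carrier → Carrier → Set
      Step s m = (m ≡ O → β s m ≡ x₀) ×
                 (∀ i → m ≡ i ⊕ I → Sat φ (β s m ∷ (β s i ∷ (i ∷ ρ))))

      sem⁺ : ∀ s m → Step s m → Sat ψ (m ∷ (s ∷ (x₀ ∷ ρ)))
      sem⁺ s m (p , q) = (λ e → Beta⁺ (p e)) ,
        λ i e → β s i , β s m , β-spec s i , β-spec s m , Sat-ren⁺ f-≗ φ (q i e)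

      sem⁻ : ∀ s m → Sat ψ (m ∷ (s ∷ (x₀ ∷ ρ))) → Step s m
      sem⁻ s m (p , q) = (λ e → β-unique (p e)) , λ i e → let x , y , b , b′ , r = q i e in
        subst₂ (λ y x → Sat φ (y ∷ (x ∷ (i ∷ ρ)))) (sym (β-unique b′)) (sym (β-unique b))
          (Sat-ren⁻ f-≗ φ r)

      local : ∀ s s′ m → AgreeBelow (m ⊕ I) s s′ →
        Sat ψ (m ∷ (s ∷ (x₀ ∷ ρ))) → Sat ψ (m ∷ (s′ ∷ (x₀ ∷ ρ)))
      local s s′ m agree r = let p , q = sem⁻ s m r in sem⁺ s′ m
        ( (λ e → trans (agree m (x≺x⊕I m)) (p e))
        , λ { i refl → subst₂ (λ y x → Sat φ (y ∷ (x ∷ (i ∷ ρ))))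
                (sym (agree m (x≺x⊕I m))) (sym (agree i (<-trans _ _ _ (x≺x⊕I i) (x≺x⊕I _)))) (q i refl) })

      extend : ∀ s m → Σ Carrier λ y → ∀ s′ → AgreeBelow m s s′ → β s′ m ≡ y →
        Sat ψ (m ∷ (s′ ∷ (x₀ ∷ ρ)))
      extend s m with zero-or-suc m
      ... | inj₁ refl = x₀ , λ s′ _ e → sem⁺ s′ O ((λ _ → e) , λ i e′ → ⊥-elim (suc≢O (sym e′)))
      ... | inj₂ (i , refl) = let y , p = total (β s i) i in
        y , λ s′ agree e → sem⁺ s′ (i ⊕ I)
          ( (λ e′ → ⊥-elim (suc≢O e′))
          , λ j e′ → subst (λ j → Sat φ (β s′ (i ⊕ I) ∷ (β s′ j ∷ (j ∷ ρ)))) (⊕-cancelʳ I e′)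
              (subst₂ (λ y x → Sat φ (y ∷ (x ∷ (i ∷ ρ)))) (sym e) (sym (agree i (x≺x⊕I i))) p))

  -- A code s of the sequence of iterated squares of a number ≥ 2 is an upper bound of the cut PowerCut s
  -- generated by the standard entries, and PowerCut s is closed under addition and multiplication.
  Squares : Carrier → Set
  Squares s = (I ⊕ I) ≼ β s O × (∀ k → β s (num (suc k)) ≡ β s (num k) ⊗ β s (num k))

  PowerCut : Carrier → Carrier → Set
  PowerCut s x = Σ ℕ λ k → x ≼ β s (num k)

  opaque
    -- Starting at c + 2 puts c below the first entry and makes that entry at least 2, so that
    -- squaring at least doubles. Recursion up to a nonstandard ν reaches all standard indices.
    squares-exist : ∀ {ν} → Nonstandard ν → ∀ c → Σ Carrier λ s → Squares s × PowerCut s c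
    squares-exist {ν} ν-ns c with recursion {0} (v₀ `≡ (v₁ `* v₁)) (λ ()) (λ x i → x ⊗ x , refl) (c ⊕ (I ⊕ I)) ν
    ... | s , e , p = s ,
      (subst ((I ⊕ I) ≼_) (sym e) (x≼y⊕x _ c) , λ k → p (num k) (ν-ns k)) ,
      0 , subst (c ≼_) (sym e) (x≼x⊕y c _)

    2≼square : ∀ {x} → (I ⊕ I) ≼ x → (x ⊕ x) ≼ (x ⊗ x)
    2≼square {x} p = subst (_≼ (x ⊗ x)) (solve 1 (λ x → (con 1 :+ con 1) :* x := x :+ x) refl x)
      (⊗-mono-≼ p ≼-refl)

    PowerCut-≼ : ∀ {s x y} → x ≼ y → PowerCut s y → PowerCut s x
    PowerCut-≼ p (k , q) = k , ≼-trans p q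

    -- Entries never exceed the code. This lets b + 1 serve as a base for all digits in
    -- `PowerCut b`, and c + 1 as the length of tables over all arguments in `PowerCut c`.
    PowerCut-bound : ∀ {s x} → PowerCut s x → x ≼ s
    PowerCut-bound {s} (k , p) = ≼-trans p (β-≼ s (num k))

  module _ {s : Carrier} (sq : Squares s) where
    opaque
      Squares-≽2 : ∀ k → (I ⊕ I) ≼ β s (num k)
      Squares-≽2 zero = proj₁ sq
      Squares-≽2 (suc k) = subst ((I ⊕ I) ≼_) (sym (proj₂ sq k))
        (≼-trans (≼-trans (Squares-≽2 k) (x≼x⊕y _ _)) (2≼square (Squares-≽2 k)))

      Squares-double : ∀ k → (β s (num k) ⊕ β s (num k)) ≼ β s (num (suc k))
      Squares-double k = subst ((β s (num k) ⊕ β s (num k)) ≼_) (sym (proj₂ sq k)) (2≼square (Squares-≽2 k))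

      Squares-mono : ∀ k l → β s (num k) ≼ β s (num (l ℕ.+ k))
      Squares-mono k zero = ≼-refl
      Squares-mono k (suc l) = ≼-trans (Squares-mono k l)
        (≼-trans (x≼x⊕y _ _) (Squares-double (l ℕ.+ k)))

      PowerCut-joint : ∀ {x y} → PowerCut s x → PowerCut s y → Σ ℕ λ k → x ≼ β s (num k) × y ≼ β s (num k)
      PowerCut-joint {y = y} (k , p) (l , q) = l ℕ.+ k , ≼-trans p (Squares-mono k l) ,
        subst (λ n → y ≼ β s (num n)) (ℕₚ.+-comm k l) (≼-trans q (Squares-mono l k))

      PowerCut-⊕ : ∀ {x y} → PowerCut s x → PowerCut s y → PowerCut s (x ⊕ y)
      PowerCut-⊕ p q = let k , p′ , q′ = PowerCut-joint p q in
        suc k , ≼-trans (⊕-mono-≼ p′ q′) (Squares-double k)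

      PowerCut-⊗ : ∀ {x y} → PowerCut s x → PowerCut s y → PowerCut s (x ⊗ y)
      PowerCut-⊗ {x} {y} p q = let k , p′ , q′ = PowerCut-joint p q in
        suc k , subst ((x ⊗ y) ≼_) (sym (proj₂ sq k)) (⊗-mono-≼ p′ q′)

      PowerCut-I : PowerCut s I
      PowerCut-I = 0 , ≼-trans (x≼x⊕y I I) (proj₁ sq)

  -- Binary digits

  Odd : Carrier → Set
  Odd x = Σ Carrier λ y → x ≡ (y ⊕ y) ⊕ I

  opaque
    even≢odd : ∀ {x y} → x ⊕ x ≢ (y ⊕ y) ⊕ I
    even≢odd {x} {y} e with ≼-or-≻ x y
    ... | inj₁ p = ≼⇒⊁ (subst (_≼ (y ⊕ y)) e (⊕-mono-≼ p p)) (x≺x⊕I _)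
    ... | inj₂ p = ≼⇒⊁ (inj₂ e) (sucˡ≼⇒≺ (subst (_≼ (x ⊕ x))
        (solve 1 (λ y → y :+ con 1 :+ (y :+ con 1) := y :+ y :+ con 1 :+ con 1) refl y)
        (⊕-mono-≼ (≺⇒sucˡ≼ p) (≺⇒sucˡ≼ p))))

    num-2^suc : ∀ n → num (2 ℕ.^ suc n) ≡ num (2 ℕ.^ n) ⊕ num (2 ℕ.^ n)
    num-2^suc n = trans (num-+ (2 ℕ.^ n) (2 ℕ.^ n ℕ.+ 0))
      (cong (λ k → num (2 ℕ.^ n) ⊕ num k) (ℕₚ.+-identityʳ (2 ℕ.^ n)))

  -- The successive halves h 0, h 1, … of h 0; the digit dropped at the n-th halving is 1 iff D n.
  Halving : (ℕ → Carrier) → (ℕ → Set) → Set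
  Halving h D = ∀ n → (D n × h n ≡ (h (suc n) ⊕ h (suc n)) ⊕ I) ⊎ (¬ D n × h n ≡ h (suc n) ⊕ h (suc n))

  opaque
    halving-expand : ∀ {h D} → Halving h D → ∀ n →
      Σ Carrier λ r → h 0 ≡ (h n ⊗ num (2 ℕ.^ n)) ⊕ r × r ≺ num (2 ℕ.^ n)
    halving-expand {h} hv zero = O ,
      solve 1 (λ x → x := x :* (con 0 :+ con 1) :+ con 0) refl (h 0) , O≺suc O
    halving-expand {h} hv (suc n) with halving-expand hv n | hv n
    ... | r , e , p | inj₂ (_ , e′) rewrite num-2^suc n = r ,
      trans e (trans (cong (λ x → (x ⊗ num (2 ℕ.^ n)) ⊕ r) e′)
        (solve 3 (λ x t r → (x :+ x) :* t :+ r := x :* (t :+ t) :+ r) refl (h (suc n)) (num (2 ℕ.^ n)) r)) ,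
      ≺-≼-trans p (x≼x⊕y _ _)
    ... | r , e , p | inj₁ (_ , e′) rewrite num-2^suc n = num (2 ℕ.^ n) ⊕ r ,
      trans e (trans (cong (λ x → (x ⊗ num (2 ℕ.^ n)) ⊕ r) e′)
        (solve 3 (λ x t r → (x :+ x :+ con 1) :* t :+ r := x :* (t :+ t) :+ (t :+ r))
          refl (h (suc n)) (num (2 ℕ.^ n)) r)) ,
      subst (_≺ (num (2 ℕ.^ n) ⊕ num (2 ℕ.^ n))) (+-comm r _) (+-mono-< _ _ _ p)

  opaque
    -- Dividing `h 0` by 2^n gives the quotient `h n`, whose parity is the n-th digit. A membership
    -- witness presents the same quotient as 2q + 1, and division is unique.
    halving⇒digits : ∀ {h D} → Halving h D → ∀ n → (n ∈ₐ h 0) ⇔ D n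
    halving⇒digits {h} {D} hv n with halving-expand hv n
    ... | r , e , p = mk⇔ to from
      where
      t : Carrier
      t = num (2 ℕ.^ n)

      to : n ∈ₐ h 0 → D n
      to (q , r′ , e′ , p′) with hv n
      ... | inj₁ (d , _) = d
      ... | inj₂ (_ , e″) = ⊥-elim (even≢odd (trans (sym e″) (proj₁ (division-unique p p′
          (trans (sym e) (trans e′ (trans (cong (λ s → ((q ⊗ s) ⊕ t) ⊕ r′) (num-2^suc n))
            (solve 3 (λ q t r → q :* (t :+ t) :+ t :+ r := (q :+ q :+ con 1) :* t :+ r) refl q t r′))))))))

      from : D n → n ∈ₐ h 0
      from d with hv n
      ... | inj₂ (¬d , _) = ⊥-elim (¬d d)
      ... | inj₁ (_ , e′) = h (suc n) , r ,
        trans e (trans (cong (λ x → (x ⊗ t) ⊕ r) e′)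
          (trans (solve 3 (λ q t r → (q :+ q :+ con 1) :* t :+ r := q :* (t :+ t) :+ t :+ r)
                   refl (h (suc n)) t r)
            (cong (λ s → ((h (suc n) ⊗ s) ⊕ t) ⊕ r) (sym (num-2^suc n))))) ,
        p

    parity : ∀ x → Σ Carrier λ y → (x ≡ (y ⊕ y) ⊕ I) ⊎ (x ≡ y ⊕ y)
    parity x with division I x
    ... | q , r , e , p with ≺suc⇒≼ p
    ...   | inj₂ refl = q , inj₁ (trans e (solve 1 (λ q → q :* (con 1 :+ con 1) :+ con 1 := q :+ q :+ con 1) refl q))
    ...   | inj₁ r≺1 with ≺suc⇒≼ (subst (r ≺_) (sym (⊕-identityˡ I)) r≺1)
    ...     | inj₁ r≺O = ⊥-elim (⊀O r≺O)
    ...     | inj₂ refl = q , inj₂ (trans e (solve 1 (λ q → q :* (con 1 :+ con 1) :+ con 0 := q :+ q) refl q))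

    -- `∈ₐ` makes sense only for standard n, through the numeral of 2^n. Storing the iterated halves
    -- of c turns it into a condition that a single formula states for all n, as overspill and
    -- comprehension require.
    digits-definable : ∀ {ν} → Nonstandard ν → ∀ c →
      Σ Carrier λ s → ∀ n → (n ∈ₐ c) ⇔ Odd (β s (num n))
    digits-definable {ν} ν-ns c
      with recursion {0} ((v₁ `≡ ((v₀ `+ v₀) `+ `1)) `∨ (v₁ `≡ (v₀ `+ v₀))) (λ ()) (λ x i → parity x) c ν
    ... | s , refl , p = s , halving⇒digits hv
      where
      hv : Halving (λ n → β s (num n)) (λ n → Odd (β s (num n)))
      hv n with p (num n) (ν-ns n)
      ... | inj₁ e = inj₁ ((_ , e) , e)
      ... | inj₂ e = inj₂ ((λ { (y , e′) → even≢odd (trans (sym e) e′) }) , e)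

    digits-exist : ∀ {n} (φ : Formula (suc n)) (ρ : Env n) {ν} → Nonstandard ν →
      Σ Carrier λ c → ∀ k → (k ∈ₐ c) ⇔ Sat φ (num k ∷ ρ)
    digits-exist {n} φ ρ {ν} ν-ns = result (recursion ψ (ν ∷ ρ) total O ν)
      where
      f : Fin (suc n) → Fin (suc (suc (suc (suc (suc n)))))
      f = liftᵣ (λ i → suc (suc (suc (suc i))))

      f-≗ : ∀ {x a b c d} → (x ∷ ρ) ≗[ f ] (x ∷ (a ∷ (b ∷ (c ∷ (d ∷ ρ)))))
      f-≗ {x} = ≗-lift x (λ i → refl)

      -- Horner's scheme: step i appends the digit number ν - (i + 1).
      ψ : Formula (suc (suc (suc (suc n))))
      ψ = `∀ ((((v₃ `+ `1) `+ v₀) `≡ v₄) `⇒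
            ((ren f φ `∧ (v₁ `≡ ((v₂ `+ v₂) `+ `1))) `∨ (`¬ (ren f φ) `∧ (v₁ `≡ (v₂ `+ v₂)))))

      total : ∀ x i → Σ Carrier λ y → Sat ψ (y ∷ (x ∷ (i ∷ (ν ∷ ρ))))
      total x i with em {Σ Carrier λ j → ((i ⊕ I) ⊕ j ≡ ν) × Sat φ (j ∷ ρ)}
      ... | yes (j , e , p) = (x ⊕ x) ⊕ I , λ j′ e′ →
            inj₁ (Sat-ren⁺ f-≗ φ (subst (λ j → Sat φ (j ∷ ρ)) (⊕-cancelˡ (i ⊕ I) (trans e (sym e′))) p) , refl)
      ... | no ¬p = x ⊕ x , λ j e → inj₂ ((λ p → ¬p (j , e , Sat-ren⁻ f-≗ φ p)) , refl)

      result : (Σ Carrier λ s → β s O ≡ O ×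
          (∀ i → i ≺ ν → Sat ψ (β s (i ⊕ I) ∷ (β s i ∷ (i ∷ (ν ∷ ρ)))))) →
        Σ Carrier λ c → ∀ k → (k ∈ₐ c) ⇔ Sat φ (num k ∷ ρ)
      result (s , _ , p) = h 0 , halving⇒digits hv
        where
        w : ℕ → Carrier
        w k = proj₁ (<-diff _ _ (ν-ns k))

        w-spec : ∀ k → num k ⊕ w k ≡ ν
        w-spec k = proj₂ (<-diff _ _ (ν-ns k))

        -- Since `w k` is ν - k, this reads the doubling sequence backwards from index ν, which
        -- yields successive halves.
        h : ℕ → Carrier
        h k = β s (w k)

        w-suc : ∀ k → w (suc k) ⊕ I ≡ w k
        w-suc k = ⊕-cancelˡ (num k) (trans
          (solve 2 (λ k w → k :+ (w :+ con 1) := k :+ con 1 :+ w) refl (num k) (w (suc k)))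
          (trans (w-spec (suc k)) (sym (w-spec k))))

        hv : Halving h (λ k → Sat φ (num k ∷ ρ))
        hv k with p (w (suc k)) (≺-by (num k) (trans (+-comm _ _) (trans (cong (num k ⊕_) (w-suc k)) (w-spec k))))
                    (num k) (trans (+-comm _ _) (trans (cong (num k ⊕_) (w-suc k)) (w-spec k)))
        ... | inj₁ (q , e) = inj₁ (Sat-ren⁻ f-≗ φ q , trans (cong (β s) (sym (w-suc k))) e)
        ... | inj₂ (q , e) = inj₂ ((λ r → q (Sat-ren⁺ f-≗ φ r)) , trans (cong (β s) (sym (w-suc k))) e)

  -- A table closed under the Δ₀-operations

  opaque
    num-injective : ∀ {m n} → num m ≡ num n → m ≡ n
    num-injective {zero} {zero} e = refl
    num-injective {zero} {suc n} e = ⊥-elim (suc≢O (sym e))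
    num-injective {suc m} {zero} e = ⊥-elim (suc≢O e)
    num-injective {suc m} {suc n} e = cong suc (num-injective (⊕-cancelʳ I e))

  `num : ∀ {n} → ℕ → Term n
  `num zero = `0
  `num (suc k) = `num k `+ `1

  ⟦`num⟧ : ∀ {n} k (ρ : Env n) → ⟦ `num k ⟧ ρ ≡ num k
  ⟦`num⟧ zero ρ = refl
  ⟦`num⟧ (suc k) ρ = cong (_⊕ I) (⟦`num⟧ k ρ)

  -- The index m of a function in the table encodes an operation o and the indices i, j < m of its arguments.
  Code : Carrier → Carrier → Carrier → Carrier → Set
  Code m o i j = Σ Carrier λ p → Σ Carrier λ q → Pair i j p × Pair o p q × m ≡ q ⊕ I

  `Code : ∀ {n} → Term n → Term n → Term n → Term n → Formula n
  `Code m o i j = `∃ (`∃ (`Pair (wk (wk i)) (wk (wk j)) v₁ `∧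
    (`Pair (wk (wk o)) v₁ v₀ `∧ (wk (wk m) `≡ (v₀ `+ `1)))))

  opaque
    Code-injective : ∀ {m o i j o′ i′ j′} → Code m o i j → Code m o′ i′ j′ → o ≡ o′ × i ≡ i′ × j ≡ j′
    Code-injective {o = o} {i} {j} {o′} {i′} {j′} (p , q , a , b , refl) (p′ , q′ , a′ , b′ , e)
      with ⊕-cancelʳ I e
    ... | refl with Pair-injective {o} {p} {o′} {p′} b b′
    ...   | refl , refl with Pair-injective {i} {j} {i′} {j′} a a′
    ...     | refl , refl = refl , refl , refl

    -- The successor in `Code` makes this strict; pairing alone has the fixed point (0, 0).
    Code-≺ˡ : ∀ {m o i j} → Code m o i j → i ≺ m
    Code-≺ˡ {o = o} {i} {j} (p , q , a , b , refl) =
      ≼⇒≺suc (≼-trans (Pair-≼ˡ {i} {j} a) (Pair-≼ʳ {o} {p} b))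

    Code-≺ʳ : ∀ {m o i j} → Code m o i j → j ≺ m
    Code-≺ʳ {o = o} {i} {j} (p , q , a , b , refl) =
      ≼⇒≺suc (≼-trans (Pair-≼ʳ {i} {j} a) (Pair-≼ʳ {o} {p} b))

  triangularℕ : ℕ → ℕ
  triangularℕ zero = 0
  triangularℕ (suc n) = suc n ℕ.+ triangularℕ n

  -- Cantor pairing repeated in ℕ, so that a formula given outside M receives a standard index in
  -- the table.
  pairℕ : ℕ → ℕ → ℕ
  pairℕ i j = triangularℕ (i ℕ.+ j) ℕ.+ i

  opaque
    num-triangular : ∀ n → num n ⊗ (num n ⊕ I) ≡ num (triangularℕ n) ⊕ num (triangularℕ n)
    num-triangular zero = trans (⊗-zeroˡ _) (sym (+-identity O))
    num-triangular (suc n) rewrite num-+ n (triangularℕ n) = trans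
      (solve 1 (λ x → (x :+ con 1) :* (x :+ con 1 :+ con 1)
         := x :* (x :+ con 1) :+ (x :+ con 1 :+ (x :+ con 1))) refl (num n))
      (trans (cong (_⊕ ((num n ⊕ I) ⊕ (num n ⊕ I))) (num-triangular n))
        (solve 2 (λ x t → t :+ t :+ (x :+ con 1 :+ (x :+ con 1)) := x :+ t :+ con 1 :+ (x :+ t :+ con 1))
          refl (num n) (num (triangularℕ n))))

    num-pair : ∀ i j → Pair (num i) (num j) (num (pairℕ i j))
    num-pair i j rewrite num-+ (triangularℕ (i ℕ.+ j)) i | sym (num-+ i j) = trans
      (cong (_⊕ (num i ⊕ num i)) (num-triangular (i ℕ.+ j)))
      (solve 2 (λ t x → t :+ t :+ (x :+ x) := t :+ x :+ (t :+ x)) refl (num (triangularℕ (i ℕ.+ j))) (num i))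

  opaque
    index : ℕ → ℕ → ℕ → ℕ
    index o i j = suc (pairℕ o (pairℕ i j))

    num-Code : ∀ o i j → Code (num (index o i j)) (num o) (num i) (num j)
    num-Code o i j = _ , _ , num-pair i j , num-pair o (pairℕ i j) , refl

  -- The free variables are the value x at the environment r, r itself, the operation o,
  -- codes t and t′ of the argument functions, and the base B in which environments are written.
  -- The operations 0, …, 5 are: last digit, dropping the last digit, sum, product, equality test,
  -- and the least x < t(r) with t′ nonzero at r followed by x (t(r) if there is none).
  `clause : ℕ → Formula 6
  `clause 0 = `∃ ((v₂ `≡ ((v₀ `* v₆) `+ v₁)) `∧ (v₁ `< v₆))
  `clause 1 = `∃ (`∃ ((v₃ `≡ ((v₁ `* v₇) `+ v₀)) `∧ ((v₀ `< v₇) `∧ `Beta v₅ v₁ v₂)))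
  `clause 2 = `∃ (`∃ (`Beta v₅ v₃ v₁ `∧ (`Beta v₆ v₃ v₀ `∧ (v₂ `≡ (v₁ `+ v₀)))))
  `clause 3 = `∃ (`∃ (`Beta v₅ v₃ v₁ `∧ (`Beta v₆ v₃ v₀ `∧ (v₂ `≡ (v₁ `* v₀)))))
  `clause 4 = `∃ (`∃ (`Beta v₅ v₃ v₁ `∧ (`Beta v₆ v₃ v₀ `∧
    (((v₁ `≡ v₀) `∧ (v₂ `≡ `1)) `∨ (`¬ (v₁ `≡ v₀) `∧ (v₂ `≡ `0))))))
  `clause 5 = `∃ (`Beta v₄ v₂ v₀ `∧ (((v₁ `< v₀) `∨ (v₁ `≡ v₀)) `∧
    ((`∀< v₁ (`Beta v₆ ((v₃ `* v₇) `+ v₀) `0)) `∧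
     ((v₁ `≡ v₀) `∨ `¬ (`Beta v₅ ((v₂ `* v₆) `+ v₁) `0)))))
  `clause _ = `¬ `⊥

  -- Each clause is guarded by its operation number; an operation other than 0, ..., 5, possibly
  -- nonstandard, leaves the value unconstrained.
  `clauses : ℕ → Formula 6
  `clauses zero = `¬ `⊥
  `clauses (suc k) = `clauses k `∧ ((v₂ `≡ `num k) `⇒ `clause k)

  clauseEnv : (x r o t t′ B : Carrier) → Env 6
  clauseEnv x r o t t′ B = x ∷ (r ∷ (o ∷ (t ∷ (t′ ∷ (B ∷ λ ())))))

  opaque
    clause-total : ∀ b {r o t t′} k → Σ Carrier λ x → Sat (`clause k) (clauseEnv x r o t t′ (b ⊕ I))
    clause-total b {r} 0 = let q , x , e , p = division b r in x , q , e , p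
    clause-total b {r} {t = t} 1 = let q , h , e , p = division b r in
      β t q , q , h , e , p , β-spec t q
    clause-total b {r} {t = t} {t′} 2 = _ , _ , _ , β-spec t r , β-spec t′ r , refl
    clause-total b {r} {t = t} {t′} 3 = _ , _ , _ , β-spec t r , β-spec t′ r , refl
    clause-total b {r} {t = t} {t′} 4 with em {β t r ≡ β t′ r}
    ... | yes e = I , _ , _ , β-spec t r , β-spec t′ r , inj₁ (e , refl)
    ... | no e = O , _ , _ , β-spec t r , β-spec t′ r , inj₂ (e , refl)
    clause-total b {r} {o} {t} {t′} 5 = found (least φ ρ y (inj₁ refl))
      where
      y : Carrier
      y = β t r

      -- The first disjunct makes the bound t(r) itself a solution: `least` has a starting point,
      -- and an unsuccessful search returns the bound.
      φ : Formula 5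
      φ = (v₀ `≡ v₁) `∨ `¬ (`Beta v₃ ((v₂ `* v₄) `+ v₀) `0)

      ρ : Env 4
      ρ = y ∷ (r ∷ (t′ ∷ ((b ⊕ I) ∷ λ ())))

      found : (Σ Carrier λ x → Sat φ (x ∷ ρ) × (∀ z → z ≺ x → ¬ Sat φ (z ∷ ρ))) →
        Σ Carrier λ x → Sat (`clause 5) (clauseEnv x r o t t′ (b ⊕ I))
      found (x , p , x-least) = x , y , β-spec t r ,
        ⊀⇒≽ (λ y≺x → x-least y y≺x (inj₁ refl)) , zeros , p
        where
        zeros : ∀ z → z ≺ x → Beta t′ ((r ⊗ (b ⊕ I)) ⊕ z) O
        zeros z z≺x with em {Beta t′ ((r ⊗ (b ⊕ I)) ⊕ z) O}
        ... | yes q = q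
        ... | no q = ⊥-elim (x-least z z≺x (inj₂ q))
    clause-total b (suc (suc (suc (suc (suc (suc k)))))) = O , λ z → z

    clauses-intro : ∀ {x r o t t′ B} n →
      (∀ k → o ≡ num k → Sat (`clause k) (clauseEnv x r o t t′ B)) →
      Sat (`clauses n) (clauseEnv x r o t t′ B)
    clauses-intro zero p = λ z → z
    clauses-intro (suc n) p = clauses-intro n p , λ e → p n (trans e (⟦`num⟧ n _))

    clauses-total : ∀ b {r o t t′} → Σ Carrier λ x → Sat (`clauses 6) (clauseEnv x r o t t′ (b ⊕ I))
    clauses-total b {r} {o} {t} {t′} with em {Σ ℕ λ k → o ≡ num k}
    ... | no ¬p = O , clauses-intro 6 (λ k e → ⊥-elim (¬p (k , e)))
    ... | yes (k , refl) = let x , p = clause-total b {r} {num k} {t} {t′} k in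
      x , clauses-intro 6 (λ k′ e → subst (λ k′ → Sat (`clause k′) (clauseEnv x r (num k) t t′ (b ⊕ I)))
                                      (num-injective {k} {k′} e) p)

  -- Entry m of s is itself a sequence: the values of the m-th function at the arguments r ≺ R. The
  -- condition is vacuous when m encodes no operation.
  Tabulated : Carrier → Carrier → Carrier → Carrier → Set
  Tabulated B R s m = ∀ r → r ≺ R → ∀ o i j → Code m o i j →
    Sat (`clauses 6) (clauseEnv (β (β s m) r) r o (β s i) (β s j) B)

  opaque
    -- Row m is obtained by comprehension over r from the earlier rows i and j. Minimisation may
    -- consult a row at an argument beyond R, where its value is arbitrary; evaluation therefore
    -- stays inside a cut closed under appending a digit.
    table : ∀ b R N → Σ Carrier λ s → ∀ m → m ≺ N → Tabulated (b ⊕ I) R s m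
    table b R N = let s , p = buildSequence ψ ρ local extend N in s , λ m q → sem⁻ s m (p m q)
      where
      ρ : Env 2
      ρ = R ∷ ((b ⊕ I) ∷ λ ())

      f : Fin 6 → Fin 12
      f = # 2 ∷ (# 7 ∷ (# 6 ∷ (# 1 ∷ (# 0 ∷ (# 11 ∷ λ ())))))

      full : (t′ t x t₀ j i o r m s : Carrier) → Env 12
      full t′ t x t₀ j i o r m s = t′ ∷ (t ∷ (x ∷ (t₀ ∷ (j ∷ (i ∷ (o ∷ (r ∷ (m ∷ (s ∷ ρ)))))))))

      f-≗ : ∀ t′ t x t₀ j i o r m s →
        clauseEnv x r o t t′ (b ⊕ I) ≗[ f ] full t′ t x t₀ j i o r m s
      f-≗ t′ t x t₀ j i o r m s zero = refl
      f-≗ t′ t x t₀ j i o r m s (suc zero) = refl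
      f-≗ t′ t x t₀ j i o r m s (suc (suc zero)) = refl
      f-≗ t′ t x t₀ j i o r m s (suc (suc (suc zero))) = refl
      f-≗ t′ t x t₀ j i o r m s (suc (suc (suc (suc zero)))) = refl
      f-≗ t′ t x t₀ j i o r m s (suc (suc (suc (suc (suc zero))))) = refl

      ψ : Formula 4
      ψ = `∀< v₂ (`∀ (`∀ (`∀ (`Code v₄ v₂ v₁ v₀ `⇒ `∃ (`∃ (`∃ (`∃
        (`Beta v₉ v₈ v₃ `∧ (`Beta v₃ v₇ v₂ `∧ (`Beta v₉ v₅ v₁ `∧
        (`Beta v₉ v₄ v₀ `∧ ren f (`clauses 6))))))))))))

      sem⁺ : ∀ s m → Tabulated (b ⊕ I) R s m → Sat ψ (m ∷ (s ∷ ρ))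
      sem⁺ s m p r r≺R o i j c = _ , _ , _ , _ ,
        β-spec s m , β-spec (β s m) r , β-spec s i , β-spec s j ,
        Sat-ren⁺ {f = f} {σ = full (β s j) (β s i) (β (β s m) r) (β s m) j i o r m s} (f-≗ (β s j) (β s i) (β (β s m) r) (β s m) j i o r m s) (`clauses 6) (p r r≺R o i j c)

      sem⁻ : ∀ s m → Sat ψ (m ∷ (s ∷ ρ)) → Tabulated (b ⊕ I) R s m
      sem⁻ s m p r r≺R o i j c with p r r≺R o i j c
      ... | t₀ , x , t , t′ , e₀ , e , eᵢ , eⱼ , q
        with β-unique e₀ | β-unique eᵢ | β-unique eⱼ
      ... | refl | refl | refl with β-unique e
      ... | refl = Sat-ren⁻ {f = f} {σ = full t′ t x t₀ j i o r m s} (f-≗ t′ t x t₀ j i o r m s) (`clauses 6) q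

      local : ∀ s s′ m → AgreeBelow (m ⊕ I) s s′ → Sat ψ (m ∷ (s ∷ ρ)) → Sat ψ (m ∷ (s′ ∷ ρ))
      local s s′ m agree q = sem⁺ s′ m λ r r≺R o i j c →
        subst₂ (λ t t′ → Sat (`clauses 6) (clauseEnv (β (β s′ m) r) r o t t′ (b ⊕ I)))
          (sym (agree i (<-trans _ _ _ (Code-≺ˡ {o = o} {i} {j} c) (x≺x⊕I m))))
          (sym (agree j (<-trans _ _ _ (Code-≺ʳ {o = o} {i} {j} c) (x≺x⊕I m))))
          (subst (λ t → Sat (`clauses 6) (clauseEnv (β t r) r o (β s i) (β s j) (b ⊕ I)))
            (sym (agree m (x≺x⊕I m))) (sem⁻ s m q r r≺R o i j c))

      extend : ∀ s m → Σ Carrier λ y → ∀ s′ → AgreeBelow m s s′ → β s′ m ≡ y → Sat ψ (m ∷ (s′ ∷ ρ))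
      extend s m with em {Σ Carrier λ o → Σ Carrier λ i → Σ Carrier λ j → Code m o i j}
      ... | no ¬c = O , λ s′ _ _ → sem⁺ s′ m λ r r≺R o i j c → ⊥-elim (¬c (o , i , j , c))
      ... | yes (o , i , j , c)
        with comprehension (`clauses 6) (o ∷ (β s i ∷ (β s j ∷ ((b ⊕ I) ∷ λ ()))))
               (λ r → clauses-total b {r} {o} {β s i} {β s j}) R
      ...   | y , p = y , λ s′ agree e → sem⁺ s′ m (tabulated s′ agree e)
        where
        tabulated : ∀ s′ → AgreeBelow m s s′ → β s′ m ≡ y → Tabulated (b ⊕ I) R s′ m
        tabulated s′ agree refl r r≺R o′ i′ j′ c′
          with Code-injective {o = o} {i} {j} {o′} {i′} {j′} c c′
        ... | refl , refl , refl
          rewrite agree i (Code-≺ˡ {o = o} {i} {j} c) | agree j (Code-≺ʳ {o = o} {i} {j} c) = p r r≺R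

  -- Evaluation of Δ₀-formulas

  opaque
    clauses-elim : ∀ {x r t t′ B} k l → Sat (`clauses (l ℕ.+ suc k)) (clauseEnv x r (num k) t t′ B) →
      Sat (`clause k) (clauseEnv x r (num k) t t′ B)
    clauses-elim k zero (_ , p) = p (sym (⟦`num⟧ k _))
    clauses-elim k (suc l) (p , _) = clauses-elim k l p

  -- Constants come from the equality test: a value equals itself, which gives 1, and 1 differs from
  -- 1 + 1, which gives 0.
  headᵢ oneᵢ zeroᵢ : ℕ
  headᵢ = index 0 0 0
  oneᵢ = index 4 headᵢ headᵢ
  zeroᵢ = index 4 oneᵢ (index 2 oneᵢ oneᵢ)

  tailᵢ notᵢ : ℕ → ℕ
  tailᵢ i = index 1 i 0
  notᵢ i = index 4 i zeroᵢ

  -- Minimisation returns its bound exactly when no witness lies below it, so `exᵢ` negates that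
  -- equality.
  addᵢ mulᵢ eqᵢ minᵢ exᵢ : ℕ → ℕ → ℕ
  addᵢ = index 2
  mulᵢ = index 3
  eqᵢ = index 4
  minᵢ = index 5
  exᵢ i j = notᵢ (eqᵢ (minᵢ i j) i)

  varᵢ : ∀ {n} → Fin n → ℕ
  varᵢ zero = headᵢ
  varᵢ (suc i) = tailᵢ (varᵢ i)

  termᵢ : ∀ {n} → Term n → ℕ
  termᵢ (var i) = varᵢ i
  termᵢ `0 = zeroᵢ
  termᵢ `1 = oneᵢ
  termᵢ (s `+ t) = addᵢ (termᵢ s) (termᵢ t)
  termᵢ (s `* t) = mulᵢ (termᵢ s) (termᵢ t)

  -- Truth of a formula is encoded as a nonzero value.
  formulaᵢ : ∀ {n} {φ : Formula n} → Δ₀ φ → ℕ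
  formulaᵢ (eq s t) = eqᵢ (termᵢ s) (termᵢ t)
  -- No operation tests order, so s < t is read as "some x < t equals s"; `tailᵢ` evaluates s in the
  -- environment without x.
  formulaᵢ (lt s t) = exᵢ (termᵢ t) (eqᵢ headᵢ (tailᵢ (termᵢ s)))
  formulaᵢ bot = zeroᵢ
  formulaᵢ (and φ ψ) = mulᵢ (formulaᵢ φ) (formulaᵢ ψ)
  formulaᵢ (or φ ψ) = addᵢ (formulaᵢ φ) (formulaᵢ ψ)
  formulaᵢ (imp φ ψ) = addᵢ (notᵢ (formulaᵢ φ)) (formulaᵢ ψ)
  formulaᵢ (ball t φ) = notᵢ (exᵢ (termᵢ t) (notᵢ (formulaᵢ φ)))
  formulaᵢ (bex t φ) = exᵢ (termᵢ t) (formulaᵢ φ)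

  ≢O-stable : ∀ {x} → ¬ (x ≢ O) → x ≡ O
  ≢O-stable {x} p with em {x ≡ O}
  ... | yes e = e
  ... | no e = ⊥-elim (p e)

  -- Two cuts keep the evaluation within the table. Values of variables and terms lie in
  -- `PowerCut b`, so they are digits in base B; environments lie in `PowerCut c`, which contains B
  -- and so is closed under appending a digit.
  module Evaluation {b c s ν : Carrier} (b-sq : Squares b) (c-sq : Squares c)
    (B∈c : PowerCut c (b ⊕ I)) (ν-ns : Nonstandard ν)
    (tab : ∀ m → m ≺ ν → Tabulated (b ⊕ I) (c ⊕ I) s m) where

    B : Carrier
    B = b ⊕ I

    val : ℕ → Carrier → Carrier
    val k r = β (β s (num k)) r

    -- The innermost variable is the last digit; whatever precedes the digits of the listed
    -- variables is arbitrary.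
    Represents : ∀ {n} → Env n → Carrier → Set
    Represents {zero} ρ r = ⊤
    Represents {suc n} ρ r = Σ Carrier λ q → r ≡ (q ⊗ B) ⊕ ρ zero × ρ zero ≺ B × Represents (λ i → ρ (suc i)) q

    opaque
      clause-at : ∀ o l → l ℕ.+ suc o ≡ 6 → ∀ i j {r} → PowerCut c r →
        Sat (`clause o) (clauseEnv (val (index o i j) r) r (num o) (β s (num i)) (β s (num j)) B)
      clause-at o l e i j {r} r∈c =
        clauses-elim {val (index o i j) r} {r} {β s (num i)} {β s (num j)} {B} o l
        (subst (λ n → Sat (`clauses n) (clauseEnv (val (index o i j) r) r (num o) (β s (num i)) (β s (num j)) B)) (sym e)
          (tab (num (index o i j)) (ν-ns (index o i j)) r (≼⇒≺suc (PowerCut-bound r∈c)) (num o) (num i) (num j)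
            (num-Code o i j)))

      quotient∈c : ∀ {r q h} → PowerCut c r → r ≡ (q ⊗ B) ⊕ h → PowerCut c q
      quotient∈c {q = q} r∈c refl = PowerCut-≼ (≼-trans (x≼x⊗sucy q b) (x≼x⊕y _ _)) r∈c

      push∈c : ∀ {r x} → PowerCut c r → x ≺ B → PowerCut c ((r ⊗ B) ⊕ x)
      push∈c r∈c x≺B = PowerCut-⊕ c-sq (PowerCut-⊗ c-sq r∈c B∈c) (PowerCut-≼ (inj₁ x≺B) B∈c)

      ≺B : ∀ {x} → PowerCut b x → x ≺ B
      ≺B x∈b = ≼⇒≺suc (PowerCut-bound x∈b)

      val-head : ∀ {r q h} → PowerCut c r → r ≡ (q ⊗ B) ⊕ h → h ≺ B → val headᵢ r ≡ h
      val-head r∈c e h≺B = let q′ , e′ , p = clause-at 0 5 refl 0 0 r∈c in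
        proj₂ (division-unique p h≺B (trans (sym e′) e))

      val-tail : ∀ i {r q h} → PowerCut c r → r ≡ (q ⊗ B) ⊕ h → h ≺ B → val (tailᵢ i) r ≡ val i q
      val-tail i r∈c e h≺B with clause-at 1 4 refl i 0 r∈c
      ... | q′ , h′ , e′ , p , bt with proj₁ (division-unique p h≺B (trans (sym e′) e))
      ... | refl = sym (β-unique bt)

      val-add : ∀ i j {r} → PowerCut c r → val (addᵢ i j) r ≡ val i r ⊕ val j r
      val-add i j r∈c = let y , z , p , q , e = clause-at 2 3 refl i j r∈c in
        trans e (sym (cong₂ _⊕_ (β-unique p) (β-unique q)))

      val-mul : ∀ i j {r} → PowerCut c r → val (mulᵢ i j) r ≡ val i r ⊗ val j r
      val-mul i j r∈c = let y , z , p , q , e = clause-at 3 2 refl i j r∈c in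
        trans e (sym (cong₂ _⊗_ (β-unique p) (β-unique q)))

      val-eq : ∀ i j {r} → PowerCut c r →
        (val i r ≡ val j r × val (eqᵢ i j) r ≡ I) ⊎ (val i r ≢ val j r × val (eqᵢ i j) r ≡ O)
      val-eq i j r∈c with clause-at 4 1 refl i j r∈c
      ... | y , z , p , q , d with β-unique p | β-unique q
      ... | refl | refl = d

      val-min : ∀ i j {r} → PowerCut c r → let x = val (minᵢ i j) r in
        x ≼ val i r × (∀ z → z ≺ x → val j ((r ⊗ B) ⊕ z) ≡ O) × (x ≡ val i r ⊎ val j ((r ⊗ B) ⊕ x) ≢ O)
      val-min i j r∈c with clause-at 5 0 refl i j r∈c
      ... | y , p , x≼y , zeros , d with β-unique p
      ... | refl = x≼y , (λ z q → β-unique (zeros z q)) , Sum.map₂ (λ n e → n (Beta⁺ e)) d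

    val-eq-≢O : ∀ i j {r} → PowerCut c r → (val (eqᵢ i j) r ≢ O) ⇔ (val i r ≡ val j r)
    val-eq-≢O i j r∈c with val-eq i j r∈c
    ... | inj₁ (p , e) = mk⇔ (λ _ → p) (λ _ e′ → I≢O (trans (sym e) e′))
    ... | inj₂ (p , e) = mk⇔ (λ n → ⊥-elim (n e)) (λ e′ → ⊥-elim (p e′))

    val-one : ∀ {r} → PowerCut c r → val oneᵢ r ≡ I
    val-one r∈c with val-eq headᵢ headᵢ r∈c
    ... | inj₁ (_ , e) = e
    ... | inj₂ (p , _) = ⊥-elim (p refl)

    val-zero : ∀ {r} → PowerCut c r → val zeroᵢ r ≡ O
    val-zero r∈c with val-eq oneᵢ (addᵢ oneᵢ oneᵢ) r∈c
    ... | inj₂ (_ , e) = e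
    ... | inj₁ (p , _) = ⊥-elim (<-irrefl I (subst (I ≺_)
      (sym (trans (sym (val-one r∈c)) (trans p (trans (val-add oneᵢ oneᵢ r∈c) (cong₂ _⊕_ (val-one r∈c) (val-one r∈c))))))
      (x≺x⊕I I)))

    val-not : ∀ i {r} → PowerCut c r → (val (notᵢ i) r ≢ O) ⇔ (val i r ≡ O)
    val-not i r∈c = mk⇔ (λ n → trans (Equivalence.to eqv n) (val-zero r∈c))
      (λ e → Equivalence.from eqv (trans e (sym (val-zero r∈c))))
      where
      eqv = val-eq-≢O i zeroᵢ r∈c

    val-ex : ∀ i j {r} → PowerCut c r →
      (val (exᵢ i j) r ≢ O) ⇔ (Σ Carrier λ x → x ≺ val i r × val j ((r ⊗ B) ⊕ x) ≢ O)
    val-ex i j {r} r∈c = mk⇔ to from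
      where
      x : Carrier
      x = val (minᵢ i j) r

      not-eq = val-not (eqᵢ (minᵢ i j) i) r∈c
      eqv = val-eq-≢O (minᵢ i j) i r∈c

      to : val (exᵢ i j) r ≢ O → Σ Carrier λ x → x ≺ val i r × val j ((r ⊗ B) ⊕ x) ≢ O
      to n with val-min i j r∈c
      ... | _ , _ , inj₁ e = ⊥-elim (Equivalence.from eqv e (Equivalence.to not-eq n))
      ... | inj₂ e , _ = ⊥-elim (Equivalence.from eqv e (Equivalence.to not-eq n))
      ... | inj₁ x≺ , _ , inj₂ nz = x , x≺ , nz

      from : (Σ Carrier λ x → x ≺ val i r × val j ((r ⊗ B) ⊕ x) ≢ O) → val (exᵢ i j) r ≢ O
      from (y , y≺ , nz) = Equivalence.from not-eq (≢O-stable λ n →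
        nz (proj₁ (proj₂ (val-min i j r∈c)) y (subst (y ≺_) (sym (Equivalence.to eqv n)) y≺)))

    opaque
      val-var : ∀ {n} (i : Fin n) {ρ : Env n} {r} → Represents ρ r → PowerCut c r → val (varᵢ i) r ≡ ρ i
      val-var zero (q , e , p , _) r∈c = val-head r∈c e p
      val-var (suc i) (q , e , p , rep) r∈c =
        trans (val-tail (varᵢ i) r∈c e p) (val-var i rep (quotient∈c r∈c e))

      val-term : ∀ {n} (t : Term n) {ρ : Env n} {r} → Represents ρ r → PowerCut c r →
        val (termᵢ t) r ≡ ⟦ t ⟧ ρ
      val-term (var i) rep r∈c = val-var i rep r∈c
      val-term `0 rep r∈c = val-zero r∈c
      val-term `1 rep r∈c = val-one r∈c
      val-term (t `+ u) rep r∈c =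
        trans (val-add _ _ r∈c) (cong₂ _⊕_ (val-term t rep r∈c) (val-term u rep r∈c))
      val-term (t `* u) rep r∈c =
        trans (val-mul _ _ r∈c) (cong₂ _⊗_ (val-term t rep r∈c) (val-term u rep r∈c))

      term∈b : ∀ {n} (t : Term n) {ρ : Env n} → (∀ i → PowerCut b (ρ i)) → PowerCut b (⟦ t ⟧ ρ)
      term∈b (var i) ρ∈b = ρ∈b i
      term∈b `0 ρ∈b = PowerCut-≼ (O≼ I) (PowerCut-I b-sq)
      term∈b `1 ρ∈b = PowerCut-I b-sq
      term∈b (t `+ u) ρ∈b = PowerCut-⊕ b-sq (term∈b t ρ∈b) (term∈b u ρ∈b)
      term∈b (t `* u) ρ∈b = PowerCut-⊗ b-sq (term∈b t ρ∈b) (term∈b u ρ∈b)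

    ∷∈b : ∀ {n} {ρ : Env n} {x} → PowerCut b x → (∀ i → PowerCut b (ρ i)) → ∀ i → PowerCut b ((x ∷ ρ) i)
    ∷∈b x∈b ρ∈b zero = x∈b
    ∷∈b x∈b ρ∈b (suc i) = ρ∈b i

    Correct : ∀ {n} {φ : Formula n} → Δ₀ φ → Set
    Correct {n} {φ} δ = ∀ {ρ : Env n} {r} → Represents ρ r → PowerCut c r → (∀ i → PowerCut b (ρ i)) →
      (val (formulaᵢ δ) r ≢ O) ⇔ Sat φ ρ

    opaque
      -- The induction step shared by both bounded quantifiers: x lies under the value of a term,
      -- hence is a digit, and pushing it onto r stays in `PowerCut c`.
      below : ∀ {n} (t : Term n) {φ : Formula (suc n)} (δ : Δ₀ φ) → Correct δ →
        ∀ {ρ : Env n} {r} → Represents ρ r → PowerCut c r → (∀ i → PowerCut b (ρ i)) →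
        ∀ {x} → x ≺ ⟦ t ⟧ ρ → PowerCut c ((r ⊗ B) ⊕ x) ×
          ((val (formulaᵢ δ) ((r ⊗ B) ⊕ x) ≢ O) ⇔ Sat φ (x ∷ ρ))
      below t δ correct {ρ} {r} rep r∈c ρ∈b {x} x≺t = rx∈c ,
        correct (r , refl , ≺B x∈b , rep) rx∈c (∷∈b x∈b ρ∈b)
        where
        x∈b : PowerCut b x
        x∈b = PowerCut-≼ (inj₁ x≺t) (term∈b t ρ∈b)

        rx∈c : PowerCut c ((r ⊗ B) ⊕ x)
        rx∈c = push∈c r∈c (≺B x∈b)

    open Equivalence

    -- Induction on `δ`, with nonzero read as true: a product of nonzero values is nonzero, a sum
    -- vanishes only if both summands do, and a bounded quantifier is a search by `val-ex`, the
    -- universal one being treated as ¬∃¬ by excluded middle.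
    val-formula : ∀ {n} {φ : Formula n} (δ : Δ₀ φ) → Correct δ
    val-formula (eq t u) rep r∈c ρ∈b = mk⇔
      (λ n → trans (sym (val-term t rep r∈c)) (trans (to eqv n) (val-term u rep r∈c)))
      (λ e → from eqv (trans (val-term t rep r∈c) (trans e (sym (val-term u rep r∈c)))))
      where
      eqv = val-eq-≢O (termᵢ t) (termᵢ u) r∈c
    val-formula (lt t u) {ρ} {r} rep r∈c ρ∈b = mk⇔
      (λ n → let x , x≺ , nz = to ex n
                 x≺u = subst (x ≺_) (val-term u rep r∈c) x≺
             in subst (_≺ ⟦ u ⟧ ρ) (to (t-is x x≺u) nz) x≺u)
      (λ t≺u → from ex (⟦ t ⟧ ρ , subst (⟦ t ⟧ ρ ≺_) (sym (val-term u rep r∈c)) t≺u ,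
                          from (t-is _ t≺u) refl))
      where
      ex = val-ex (termᵢ u) (eqᵢ headᵢ (tailᵢ (termᵢ t))) r∈c

      t-is : ∀ x → x ≺ ⟦ u ⟧ ρ →
        (val (eqᵢ headᵢ (tailᵢ (termᵢ t))) ((r ⊗ B) ⊕ x) ≢ O) ⇔ (x ≡ ⟦ t ⟧ ρ)
      t-is x x≺u = mk⇔
        (λ n → trans (sym head-x) (trans (to eqv n) tail-t))
        (λ e → from eqv (trans head-x (trans e (sym tail-t))))
        where
        x≺B : x ≺ B
        x≺B = ≺B (PowerCut-≼ (inj₁ x≺u) (term∈b u ρ∈b))

        rx∈c : PowerCut c ((r ⊗ B) ⊕ x)
        rx∈c = push∈c r∈c x≺B

        eqv = val-eq-≢O headᵢ (tailᵢ (termᵢ t)) rx∈c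

        head-x : val headᵢ ((r ⊗ B) ⊕ x) ≡ x
        head-x = val-head rx∈c refl x≺B

        tail-t : val (tailᵢ (termᵢ t)) ((r ⊗ B) ⊕ x) ≡ ⟦ t ⟧ ρ
        tail-t = trans (val-tail (termᵢ t) rx∈c refl x≺B) (val-term t rep r∈c)
    val-formula bot rep r∈c ρ∈b = mk⇔ (λ n → n (val-zero r∈c)) ⊥-elim
    val-formula (and δ ε) rep r∈c ρ∈b = mk⇔
      (λ n → to ihδ (λ e → n (trans mul (trans (cong (_⊗ _) e) (⊗-zeroˡ _)))) ,
             to ihε (λ e → n (trans mul (trans (cong (_ ⊗_) e) (*-zero _)))))
      (λ { (p , q) e → ⊗-nonzero (from ihδ p) (from ihε q) (trans (sym mul) e) })
      where
      ihδ = val-formula δ rep r∈c ρ∈b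
      ihε = val-formula ε rep r∈c ρ∈b
      mul = val-mul (formulaᵢ δ) (formulaᵢ ε) r∈c
    val-formula (or {φ = φ} {ψ} δ ε) {ρ} {r} rep r∈c ρ∈b = mk⇔ ⇒
      (λ { (inj₁ p) e → from ihδ p (⊕-zeroˡ⁻ (trans (sym add) e))
         ; (inj₂ p) e → from ihε p (⊕-zeroʳ⁻ (trans (sym add) e)) })
      where
      ihδ = val-formula δ rep r∈c ρ∈b
      ihε = val-formula ε rep r∈c ρ∈b
      add = val-add (formulaᵢ δ) (formulaᵢ ε) r∈c

      ⇒ : val (formulaᵢ (or δ ε)) r ≢ O → Sat φ ρ ⊎ Sat ψ ρ
      ⇒ n with em {val (formulaᵢ δ) r ≡ O}
      ... | no p = inj₁ (to ihδ p)
      ... | yes e = inj₂ (to ihε λ e′ → n (trans add (trans (cong₂ _⊕_ e e′) (+-identity O))))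
    val-formula (imp {φ = φ} {ψ} δ ε) {ρ} {r} rep r∈c ρ∈b = mk⇔
      (λ n p → to ihε λ e → n (trans add (trans
        (cong₂ _⊕_ (≢O-stable λ nz → from ihδ p (to neg nz)) e) (+-identity O))))
      (λ p e → from ihε (p (to ihδ λ e′ → from neg e′ (⊕-zeroˡ⁻ (trans (sym add) e))))
                 (⊕-zeroʳ⁻ (trans (sym add) e)))
      where
      ihδ = val-formula δ rep r∈c ρ∈b
      ihε = val-formula ε rep r∈c ρ∈b
      neg = val-not (formulaᵢ δ) r∈c
      add = val-add (notᵢ (formulaᵢ δ)) (formulaᵢ ε) r∈c
    val-formula (ball t δ) {ρ} {r} rep r∈c ρ∈b = mk⇔
      (λ n x x≺t → let rx∈c , ih = below t δ (val-formula δ) rep r∈c ρ∈b x≺t in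
        to ih λ e → from ex (x , subst (x ≺_) (sym (val-term t rep r∈c)) x≺t ,
                               from (val-not (formulaᵢ δ) rx∈c) e) (to neg n))
      (λ p → from neg (≢O-stable λ n → let x , x≺ , nz = to ex n
                                           x≺t = subst (x ≺_) (val-term t rep r∈c) x≺
                                           rx∈c , ih = below t δ (val-formula δ) rep r∈c ρ∈b x≺t
                                       in from ih (p x x≺t) (to (val-not (formulaᵢ δ) rx∈c) nz)))
      where
      ex = val-ex (termᵢ t) (notᵢ (formulaᵢ δ)) r∈c
      neg = val-not (exᵢ (termᵢ t) (notᵢ (formulaᵢ δ))) r∈c
    val-formula (bex t δ) {ρ} {r} rep r∈c ρ∈b = mk⇔
      (λ n → let x , x≺ , nz = to ex n
                 x≺t = subst (x ≺_) (val-term t rep r∈c) x≺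
             in x , x≺t , to (proj₂ (below t δ (val-formula δ) rep r∈c ρ∈b x≺t)) nz)
      (λ { (x , x≺t , p) → from ex (x , subst (x ≺_) (sym (val-term t rep r∈c)) x≺t ,
             from (proj₂ (below t δ (val-formula δ) rep r∈c ρ∈b x≺t)) p) })
      where
      ex = val-ex (termᵢ t) (formulaᵢ δ) r∈c

  -- Cuts

  opaque
    -- An element y ≺ e defined by `ψ` from a is the least z ≺ e satisfying `ψ`. The search for it
    -- is a function of standard index in the table, evaluated at the code `r₀` of the environment
    -- (a, e), and d lists the values of the tabulated functions at `r₀`.
    enumeration : ∀ {ν} → Nonstandard ν → ∀ a e →
      Σ Carrier λ d → ∀ y → y ≺ e → Def₀ a y → Σ ℕ λ k → β d (num k) ≡ y
    enumeration {ν} ν-ns a e with squares-exist ν-ns (a ⊕ e)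
    ... | b , b-sq , ae∈b with squares-exist ν-ns (b ⊕ I)
    ... | c , c-sq , B∈c with table b (c ⊕ I) ν
    ... | s , tab = enumerate (comprehension φ (r₀ ∷ (s ∷ λ ())) (λ m → _ , _ , β-spec s m , β-spec _ r₀) ν)
      where
      open Evaluation b-sq c-sq B∈c ν-ns tab

      r₀ : Carrier
      r₀ = (((O ⊗ B) ⊕ e) ⊗ B) ⊕ a

      φ : Formula 4
      φ = `∃ (`Beta v₄ v₂ v₀ `∧ `Beta v₀ v₃ v₁)

      a∈b : PowerCut b a
      a∈b = PowerCut-≼ (x≼x⊕y a e) ae∈b

      e∈b : PowerCut b e
      e∈b = PowerCut-≼ (x≼y⊕x e a) ae∈b

      r₀∈c : PowerCut c r₀
      r₀∈c = push∈c (push∈c (PowerCut-≼ (O≼ I) (PowerCut-I c-sq)) (≺B e∈b)) (≺B a∈b)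

      ρ₀ : Env 2
      ρ₀ = a ∷ (e ∷ λ ())

      r₀-represents : Represents ρ₀ r₀
      r₀-represents = _ , refl , ≺B a∈b , O , refl , ≺B e∈b , tt

      enumerate : (Σ Carrier λ d → ∀ m → m ≺ ν → Sat φ (β d m ∷ (m ∷ (r₀ ∷ (s ∷ λ ()))))) →
        Σ Carrier λ d → ∀ y → y ≺ e → Def₀ a y → Σ ℕ λ k → β d (num k) ≡ y
      enumerate (d , d-spec) = d , found
        where
        β-d : ∀ k → β d (num k) ≡ val k r₀
        β-d k with d-spec (num k) (ν-ns k)
        ... | t , p , q with β-unique p
        ... | refl = sym (β-unique q)

        found : ∀ y → y ≺ e → Def₀ a y → Σ ℕ λ k → β d (num k) ≡ y
        found y y≺e (ψ , δ , ψ-defines) = k , trans (β-d k) (x≡y (val-min (varᵢ {2} (suc zero)) (formulaᵢ δ) r₀∈c))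
          where
          k : ℕ
          k = minᵢ (varᵢ {2} (suc zero)) (formulaᵢ δ)

          x : Carrier
          x = val k r₀

          val-e : val (varᵢ {2} (suc zero)) r₀ ≡ e
          val-e = val-var (suc zero) {ρ₀} r₀-represents r₀∈c

          ψ-correct : ∀ z → z ≺ e →
            (val (formulaᵢ δ) ((r₀ ⊗ B) ⊕ z) ≢ O) ⇔ Sat ψ (z ∷ (a ∷ λ ()))
          ψ-correct z z≺e = val-formula δ (r₀ , refl , ≺B z∈b , _ , refl , ≺B a∈b , tt)
            (push∈c r₀∈c (≺B z∈b)) (∷∈b z∈b (∷∈b a∈b λ ()))
            where
            z∈b : PowerCut b z
            z∈b = PowerCut-≼ (inj₁ z≺e) e∈b

          x≡y : x ≼ val (varᵢ {2} (suc zero)) r₀ ×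
                (∀ z → z ≺ x → val (formulaᵢ δ) ((r₀ ⊗ B) ⊕ z) ≡ O) ×
                (x ≡ val (varᵢ {2} (suc zero)) r₀ ⊎ val (formulaᵢ δ) ((r₀ ⊗ B) ⊕ x) ≢ O) →
            x ≡ y
          x≡y (_ , zeros , d) = [ at-bound , at-witness ]′ d
            where
            open Equivalence
            -- As y is a witness, the search stops at y or earlier, hence strictly below e; so it
            -- stopped at a witness, and uniqueness makes that witness y.
            x≼y : x ≼ y
            x≼y = ⊀⇒≽ λ y≺x → from (ψ-correct y y≺e) (from (ψ-defines y) refl) (zeros y y≺x)

            at-bound : x ≡ val (varᵢ {2} (suc zero)) r₀ → x ≡ y
            at-bound x≡e = ⊥-elim (≼⇒⊁ x≼y (subst (y ≺_) (sym (trans x≡e val-e)) y≺e))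

            at-witness : val (formulaᵢ δ) ((r₀ ⊗ B) ⊕ x) ≢ O → x ≡ y
            at-witness nz = to (ψ-defines x) (to (ψ-correct x (≼-≺-trans x≼y y≺e)) nz)

    -- The quantifiers of `Beta` can be bounded: the components of a pair are at most its code, and
    -- the quotient q is at most u. A standard index enters as a closed numeral.
    β-Def₀ : ∀ a i → Def₀ a (β a (num i))
    β-Def₀ a i = φ , bex _ (bex _ (and (eq _ _) (and (bex _ (eq _ _)) (lt _ _)))) , λ y → mk⇔ (to y) (from y)
      where
      φ : Formula 2
      φ = `∃< (v₁ `+ `1) (`∃< (v₂ `+ `1) (`Pair v₁ v₀ v₃ `∧
        ((`∃< (v₁ `+ `1) (v₂ `≡ ((v₀ `* `modulus v₁ (`num i)) `+ v₃))) `∧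
         (v₂ `< `modulus v₀ (`num i)))))

      to : ∀ y → Sat φ (y ∷ (a ∷ λ ())) → y ≡ β a (num i)
      to y (u , _ , v , _ , p , (q , _ , e) , y≺m) = sym (β-unique (u , v , p ,
        (q , subst (λ k → u ≡ (q ⊗ modulus v k) ⊕ y) (⟦`num⟧ i _) e) ,
        subst (λ k → y ≺ modulus v k) (⟦`num⟧ i _) y≺m))

      from : ∀ y → y ≡ β a (num i) → Sat φ (y ∷ (a ∷ λ ()))
      from y refl with β-spec a (num i)
      ... | u , v , p , (q , e) , y≺m = u , ≼⇒≺suc (Pair-≼ˡ {u} {v} p) , v , ≼⇒≺suc (Pair-≼ʳ {u} {v} p) , p ,
        (q , ≼⇒≺suc q≼u , subst (λ k → u ≡ (q ⊗ modulus v k) ⊕ y) (sym (⟦`num⟧ i _)) e) ,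
        subst (λ k → y ≺ modulus v k) (sym (⟦`num⟧ i _)) y≺m
        where
        q≼u : q ≼ u
        q≼u = subst (q ≼_) (sym e) (≼-by ((q ⊗ ((num i ⊕ I) ⊗ v)) ⊕ y)
          (solve 3 (λ q n y → q :+ (q :* n :+ y) := q :* (con 1 :+ n) :+ y) refl q ((num i ⊕ I) ⊗ v) y))

    constant : ∀ e → Σ Carrier λ a → ∀ i → β a i ≡ e
    constant e with pair e (e ⊕ I)
    -- With second component e + 1 every modulus exceeds e, so e is its own remainder.
    ... | a , p = a , λ i → β-unique (e , e ⊕ I , p ,
      (O , sym (trans (cong (_⊕ e) (⊗-zeroˡ _)) (⊕-identityˡ e))) , ≺-modulus i (x≺x⊕I e))

  `Odd-at : ∀ {n} → Term n → Term n → Formula n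
  `Odd-at s i = `∃ (`Beta (wk s) (wk i) v₀ `∧ `∃ (v₁ `≡ ((v₀ `+ v₀) `+ `1)))

  Odd-at : Carrier → Carrier → Set
  Odd-at s i = Σ Carrier λ w → Beta s i w × Odd w

  opaque
    Odd-at⇔ : ∀ {s i} → Odd-at s i ⇔ Odd (β s i)
    Odd-at⇔ {s} {i} = mk⇔ (λ { (w , p , o) → subst Odd (sym (β-unique p)) o }) (λ o → β s i , β-spec s i , o)

  -- Sequences approaching a cut

  module _ (C : Carrier → Set) (isCut : IsCut C) where
    open IsCut isCut
    open Equivalence

    C-≼ : ∀ {x y} → x ≼ y → C y → C x
    C-≼ (inj₁ p) = initial _ _ p
    C-≼ (inj₂ refl) q = q

    C-≺ : ∀ {x y} → C x → ¬ C y → x ≺ y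
    C-≺ {x} {y} p q with ≼-or-≻ y x
    ... | inj₁ r = ⊥-elim (q (C-≼ r p))
    ... | inj₂ r = r

    C-num : ∀ n → C (num n)
    C-num zero = nonempty
    C-num (suc n) = succClosed _ (C-num n)

    ν : Carrier
    ν = proj₁ proper

    ν∉C : ¬ C ν
    ν∉C = proj₂ proper

    ν-ns : Nonstandard ν
    ν-ns n = C-≺ (C-num n) ν∉C

    SeqCofinal : Carrier → Set
    SeqCofinal a = ∀ x → C x → Σ ℕ λ i → C (β a (num i)) × x ≼ β a (num i)

    SeqCoinitial : Carrier → Set
    SeqCoinitial a = ∀ x → ¬ C x → Σ ℕ λ i → ¬ C (β a (num i)) × β a (num i) ≼ x

    opaque
      SeqCofinal⇒Def₀ : ∀ {a} → SeqCofinal a → CofinalIn (Def₀ a) C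
      SeqCofinal⇒Def₀ {a} cof x p = let i , q , r = cof x p in β a (num i) , β-Def₀ a i , q , r

      SeqCoinitial⇒Def₀ : ∀ {a} → SeqCoinitial a → CoinitialAbove (Def₀ a) C
      SeqCoinitial⇒Def₀ {a} coi x p = let i , q , r = coi x p in β a (num i) , β-Def₀ a i , q , r

      -- All of C lies below ν, so a list of the definable elements below ν contains every one that
      -- matters.
      Def₀⇒SeqCofinal : ∀ {b} → CofinalIn (Def₀ b) C → Σ Carrier SeqCofinal
      Def₀⇒SeqCofinal {b} cof with enumeration ν-ns b ν
      ... | d , enum = d , cofinal
        where
        cofinal : SeqCofinal d
        cofinal x p with cof x p
        ... | y , y-def , q , r with enum y (C-≺ q ν∉C) y-def
        ... | k , refl = k , q , r

      Def₀⇒SeqCoinitial : ∀ {b} → CoinitialAbove (Def₀ b) C → Σ Carrier SeqCoinitial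
      Def₀⇒SeqCoinitial {b} coi with enumeration ν-ns b (ν ⊕ I)
      ... | d , enum = d , coinitial
        where
        pick : ∀ x y → Def₀ b y → ¬ C y → y ≼ ν → y ≼ x → Σ ℕ λ i → ¬ C (β d (num i)) × β d (num i) ≼ x
        pick x y y-def q r r′ with enum y (≼⇒≺suc r) y-def
        ... | k , refl = k , q , r′

        coinitial : SeqCoinitial d
        coinitial x p with ≼-or-≻ x ν
        ... | inj₁ x≼ν = let y , y-def , q , r = coi x p in pick x y y-def q (≼-trans r x≼ν) r
        -- Only elements up to ν are listed; for x above ν, one that lies below ν serves.
        ... | inj₂ ν≺x = let y , y-def , q , r = coi ν ν∉C in
                pick x y y-def q r (≼-trans r (inj₁ ν≺x))

    -- Consequences of separability

    module _ (sep : Separable C) where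
      opaque
        -- The predicate C is external to M; for the terms of one sequence this replaces it by a
        -- formula with parameter s, available to overspill and comprehension.
        membership-coded : ∀ a → Σ Carrier λ s → ∀ n → C (β a (num n)) ⇔ Odd-at s (num n)
        membership-coded a with sep a
        ... | c , c-spec with digits-definable ν-ns c
        ... | s , s-spec = s , λ n → mk⇔
          (λ p → from Odd-at⇔ (to (s-spec n) (to (c-spec n) (β a (num n) , β-spec a (num n) , p))))
          (λ o → let x , b , p = from (c-spec n) (from (s-spec n) (to Odd-at⇔ o)) in
                 subst C (sym (β-unique b)) p)

        -- A running maximum, by induction outside M, with default 0 while no term lies in C.
        bounded-in-C : ∀ a k → Σ Carrier λ z → C z ×
          (∀ i → i ℕ.< k → C (β a (num i)) → β a (num i) ≼ z)
        bounded-in-C a zero = O , nonempty , λ i ()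
        bounded-in-C a (suc k) with bounded-in-C a k
        ... | z , p , z-bound with em {C (β a (num k)) × z ≺ β a (num k)}
        ...   | yes (q , r) = β a (num k) , q , bound
          where
          bound : ∀ i → i ℕ.< suc k → C (β a (num i)) → β a (num i) ≼ β a (num k)
          bound i i<k+1 c with ℕₚ.m<1+n⇒m<n∨m≡n i<k+1
          ... | inj₁ i<k = ≼-trans (z-bound i i<k c) (inj₁ r)
          ... | inj₂ refl = ≼-refl
        ...   | no ¬q = z , p , bound
          where
          bound : ∀ i → i ℕ.< suc k → C (β a (num i)) → β a (num i) ≼ z
          bound i i<k+1 c with ℕₚ.m<1+n⇒m<n∨m≡n i<k+1
          ... | inj₁ i<k = z-bound i i<k c
          ... | inj₂ refl = ⊀⇒≽ λ r → ¬q (c , r)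

        no-gap : ∀ {a d} → SeqCofinal a → SeqCoinitial d → ⊥
        no-gap {a} {d} cof coi with membership-coded a | membership-coded d
        ... | sa , sa-spec | sd , sd-spec = contradict (overspill φ ρ ν ν-ns holds)
          where
          ρ : Env 4
          ρ = a ∷ (d ∷ (sa ∷ (sd ∷ λ ())))

          φ : Formula 5
          φ = `∃ (`∀< v₁
            ((`Odd-at v₅ v₀ `⇒ `∃ (`Beta v₄ v₁ v₀ `∧ ((v₀ `< v₂) `∨ (v₀ `≡ v₂)))) `∧
             (`¬ (`Odd-at v₆ v₀) `⇒ `∃ (`Beta v₅ v₁ v₀ `∧ (v₂ `< v₀)))))

          holds : ∀ k → Sat φ (num k ∷ ρ)
          holds k with bounded-in-C a k
          ... | z , z∈C , z-bound = z , separates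
            where
            separates : ∀ i → i ≺ num k →
              (Odd-at sa i → Σ Carrier λ x → Beta a i x × x ≼ z) ×
              (¬ Odd-at sd i → Σ Carrier λ x → Beta d i x × z ≺ x)
            separates i i≺k with ≺num⇒standard k i≺k
            ... | n , n<k , refl =
              (λ o → _ , β-spec a (num n) , z-bound n n<k (from (sa-spec n) o)) ,
              (λ ¬o → _ , β-spec d (num n) , C-≺ z∈C (λ q → ¬o (to (sd-spec n) q)))

          contradict : (Σ Carrier λ n → Nonstandard n × Sat φ (n ∷ ρ)) → ⊥
          contradict (n , n-ns , z , separates) with em {C z}
          -- Cofinality is applied at z + 1 so that the term found lies strictly above z.
          ... | yes z∈C with cof (z ⊕ I) (succClosed z z∈C)
          ...   | i , q , r with proj₁ (separates (num i) (n-ns i)) (to (sa-spec i) q)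
          ...     | x , b , x≼z with β-unique b
          ...       | refl = ≼⇒⊁ x≼z (sucˡ≼⇒≺ r)
          contradict (n , n-ns , z , separates) | no z∉C with coi z z∉C
          ...   | i , q , r with proj₂ (separates (num i) (n-ns i)) (λ o → q (from (sd-spec i) o))
          ...     | x , b , z≺x with β-unique b
          ...       | refl = ≼⇒⊁ r z≺x

        -- Merges `d₁` and `d₂` according to the side of C on which the terms of d lie; with a
        -- constant sequence as one of the two, it replaces the terms on the wrong side.
        select : ∀ d d₁ d₂ → Σ Carrier λ d′ → ∀ n →
          (C (β d (num n)) × β d′ (num n) ≡ β d₁ (num n)) ⊎
          (¬ C (β d (num n)) × β d′ (num n) ≡ β d₂ (num n))
        select d d₁ d₂ with membership-coded d
        ... | s , s-spec = selected (comprehension φ ρ total ν)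
          where
          ρ : Env 3
          ρ = s ∷ (d₁ ∷ (d₂ ∷ λ ()))

          φ : Formula 5
          φ = (`Odd-at v₂ v₁ `∧ `Beta v₃ v₁ v₀) `∨ (`¬ (`Odd-at v₂ v₁) `∧ `Beta v₄ v₁ v₀)

          total : ∀ i → Σ Carrier λ x → Sat φ (x ∷ (i ∷ ρ))
          total i with em {Odd-at s i}
          ... | yes o = β d₁ i , inj₁ (o , β-spec d₁ i)
          ... | no ¬o = β d₂ i , inj₂ (¬o , β-spec d₂ i)

          selected : (Σ Carrier λ d′ → ∀ i → i ≺ ν → Sat φ (β d′ i ∷ (i ∷ ρ))) →
            Σ Carrier λ d′ → ∀ n →
              (C (β d (num n)) × β d′ (num n) ≡ β d₁ (num n)) ⊎
              (¬ C (β d (num n)) × β d′ (num n) ≡ β d₂ (num n))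
          selected (d′ , d′-spec) = d′ , at
            where
            at : ∀ n → (C (β d (num n)) × β d′ (num n) ≡ β d₁ (num n)) ⊎
                       (¬ C (β d (num n)) × β d′ (num n) ≡ β d₂ (num n))
            at n with d′-spec (num n) (ν-ns n)
            ... | inj₁ (o , p) = inj₁ (from (s-spec n) o , sym (β-unique p))
            ... | inj₂ (¬o , p) = inj₂ ((λ q → ¬o (to (s-spec n) q)) , sym (β-unique p))

        SeqCofinal⇒coded : ∀ {d} → SeqCofinal d → CodedFromBelow C
        SeqCofinal⇒coded {d} cof with constant O
        -- Terms outside C become 0, which lies in C.
        ... | zeros , zeros-spec with select d d zeros
        ... | d′ , d′-spec = d′ , λ x → mk⇔ (⇒ x) (⇐ x)
          where
          ⇒ : ∀ x → C x → Σ ℕ λ i → Σ Carrier λ y → Elem d′ i y × x ≼ y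
          ⇒ x p with cof x p
          ... | i , q , r with d′-spec i
          ...   | inj₁ (_ , e) = i , β d (num i) , Beta⁺ e , r
          ...   | inj₂ (¬q , _) = ⊥-elim (¬q q)

          ⇐ : ∀ x → (Σ ℕ λ i → Σ Carrier λ y → Elem d′ i y × x ≼ y) → C x
          ⇐ x (i , y , b , r) with β-unique b | d′-spec i
          ... | refl | inj₁ (q , e) = C-≼ r (subst C (sym e) q)
          ... | refl | inj₂ (_ , e) = C-≼ r (subst C (sym (trans e (zeros-spec _))) nonempty)

        SeqCoinitial⇒coded : ∀ {d} → SeqCoinitial d → CodedFromAbove C
        SeqCoinitial⇒coded {d} coi with constant ν
        -- Terms inside C become ν, which lies outside C.
        ... | νs , νs-spec with select d νs d
        ... | d′ , d′-spec = d′ , λ x → mk⇔ (⇒ x) (⇐ x)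
          where
          ⇒ : ∀ x → C x → ∀ i y → Elem d′ i y → x ≺ y
          ⇒ x p i y b with β-unique b | d′-spec i
          ... | refl | inj₁ (_ , e) = subst (x ≺_) (sym (trans e (νs-spec _))) (C-≺ p ν∉C)
          ... | refl | inj₂ (q , e) = subst (x ≺_) (sym e) (C-≺ p q)

          ⇐ : ∀ x → (∀ i y → Elem d′ i y → x ≺ y) → C x
          ⇐ x below with em {C x}
          ... | yes p = p
          ... | no ¬p with coi x ¬p
          ...   | i , q , r with d′-spec i
          ...     | inj₁ (q′ , _) = ⊥-elim (q q′)
          ...     | inj₂ (_ , e) = ⊥-elim (≼⇒⊁ r (below i _ (Beta⁺ e)))

    -- From codes to sequences, and from gaps to separability

    opaque
      coded⇒SeqCofinal : CodedFromBelow C → Σ Carrier SeqCofinal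
      coded⇒SeqCofinal (a , a-spec) = a , cofinal
        where
        cofinal : SeqCofinal a
        cofinal x p with to (a-spec x) p
        ... | i , y , b , r with β-unique b
        ... | refl = i , from (a-spec y) (i , y , b , ≼-refl) , r

      coded⇒SeqCoinitial : CodedFromAbove C → Σ Carrier SeqCoinitial
      coded⇒SeqCoinitial (a , a-spec) = a , coinitial
        where
        coinitial : SeqCoinitial a
        coinitial x ¬p with em {Σ ℕ λ i → β a (num i) ≼ x}
        -- A term belonging to C would be strictly below itself.
        ... | yes (i , r) = i , (λ q → <-irrefl _ (to (a-spec _) q i _ (β-spec a (num i)))) , r
        ... | no ¬r = ⊥-elim (¬p (from (a-spec x) λ i y b → above i y b))
          where
          above : ∀ i y → Elem a i y → x ≺ y
          above i y b with β-unique b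
          ... | refl with ≼-or-≻ y x
          ...   | inj₁ r = ⊥-elim (¬r (i , r))
          ...   | inj₂ r = r

      -- Comparison of a term with the fixed z is a formula, so `digits-exist` codes the set of
      -- indices satisfying it.
      threshold⇒separable :
        (∀ a → Σ Carrier λ z → ∀ n → C (β a (num n)) ⇔ (β a (num n) ≼ z)) → Separable C
      threshold⇒separable threshold a with threshold a
      ... | z , z-spec
        with digits-exist {2} (`∃ (`Beta v₂ v₁ v₀ `∧ ((v₀ `< v₃) `∨ (v₀ `≡ v₃)))) (a ∷ (z ∷ λ ())) ν-ns
      ... | c , c-spec = c , λ n → mk⇔ (⇒ n) (⇐ n)
        where
        ⇒ : ∀ n → (Σ Carrier λ x → Elem a n x × C x) → n ∈ₐ c
        ⇒ n (x , b , p) with β-unique b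
        ... | refl = from (c-spec n) (x , b , to (z-spec n) p)

        ⇐ : ∀ n → n ∈ₐ c → Σ Carrier λ x → Elem a n x × C x
        ⇐ n n∈c with to (c-spec n) n∈c
        ... | x , b , r with β-unique b
        ... | refl = x , b , from (z-spec n) r

      not-coinitial⇒separable : (∀ b → ¬ CoinitialAbove (Def₀ b) C) → Separable C
      not-coinitial⇒separable not-coi = threshold⇒separable threshold
        where
        threshold : ∀ a → Σ Carrier λ z → ∀ n → C (β a (num n)) ⇔ (β a (num n) ≼ z)
        -- Such a z lies outside C and has no element of `Def₀ a` between C and itself, so
        -- comparison with z decides on which side a term lies; if there is no such z, `Def₀ a` is
        -- coinitial.
        threshold a with em {Σ Carrier λ z → ¬ C z × ¬ (Σ Carrier λ y → Def₀ a y × ¬ C y × y ≼ z)}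
        ... | yes (z , z∉C , gap) = z , λ n → mk⇔ (λ p → inj₁ (C-≺ p z∉C)) (λ r → in-C n r)
          where
          in-C : ∀ n → β a (num n) ≼ z → C (β a (num n))
          in-C n r with em {C (β a (num n))}
          ... | yes p = p
          ... | no ¬p = ⊥-elim (gap (_ , β-Def₀ a n , ¬p , r))
        ... | no none = ⊥-elim (not-coi a coi)
          where
          coi : CoinitialAbove (Def₀ a) C
          coi x ¬p with em {Σ Carrier λ y → Def₀ a y × ¬ C y × y ≼ x}
          ... | yes q = q
          ... | no ¬q = ⊥-elim (none (x , ¬p , ¬q))

      not-cofinal⇒separable : (∀ b → ¬ CofinalIn (Def₀ b) C) → Separable C
      not-cofinal⇒separable not-cof = threshold⇒separable threshold
        where
        threshold : ∀ a → Σ Carrier λ z → ∀ n → C (β a (num n)) ⇔ (β a (num n) ≼ z)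
        threshold a with em {Σ Carrier λ z → C z × ¬ (Σ Carrier λ y → Def₀ a y × C y × z ≼ y)}
        ... | yes (z , z∈C , gap) = z , λ n → mk⇔
          (λ p → ⊀⇒≽ λ r → gap (_ , β-Def₀ a n , p , inj₁ r)) (λ r → C-≼ r z∈C)
        ... | no none = ⊥-elim (not-cof a cof)
          where
          cof : CofinalIn (Def₀ a) C
          cof x p with em {Σ Carrier λ y → Def₀ a y × C y × x ≼ y}
          ... | yes q = q
          ... | no ¬q = ⊥-elim (none (x , p , ¬q))

      coded-separable⇒superrational : ωCoded C × Separable C → ZeroSuperrational C
      coded-separable⇒superrational (inj₁ below , sep) with coded⇒SeqCofinal below
      ... | a , cof = a , inj₁ (SeqCofinal⇒Def₀ cof ,
              λ b coi → no-gap sep cof (proj₂ (Def₀⇒SeqCoinitial coi)))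
      coded-separable⇒superrational (inj₂ above , sep) with coded⇒SeqCoinitial above
      ... | a , coi = a , inj₂ (SeqCoinitial⇒Def₀ coi ,
              λ b cof → no-gap sep (proj₂ (Def₀⇒SeqCofinal cof)) coi)

      superrational⇒coded-separable : ZeroSuperrational C → ωCoded C × Separable C
      superrational⇒coded-separable (a , inj₁ (cof , not-coi)) =
        inj₁ (SeqCofinal⇒coded sep (proj₂ (Def₀⇒SeqCofinal cof))) , sep
        where
        sep : Separable C
        sep = not-coinitial⇒separable not-coi
      superrational⇒coded-separable (a , inj₂ (coi , not-cof)) =
        inj₂ (SeqCoinitial⇒coded sep (proj₂ (Def₀⇒SeqCoinitial coi))) , sep
        where
        sep : Separable C
        sep = not-cofinal⇒separable not-cof

theorem3p4 : ExcludedMiddle 0ℓ → (M : ModelPA) → (C : ModelPA.Carrier M → Set) →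
    Notions.IsCut M C →
    (Notions.ωCoded M C × Notions.Separable M C) ⇔ Notions.ZeroSuperrational M C
theorem3p4 em M C isCut =
  mk⇔ (coded-separable⇒superrational em M C isCut) (superrational⇒coded-separable em M C isCut)
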